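{- For every $\epsilon > 0$ there exists $N = N(\epsilon)$ such that for every integer $q \ge N$ the following holds: if $G$ is a simple graph that is properly edge-colored with at least $2(1+\epsilon)q$ colors such that each color appears on at least $q$ edges, then $G$ contains a rainbow matching using $q$ colors (i.e., a rainbow matching of size $q$).
   Context: A proper edge-coloring is one in which no two edges sharing a vertex receive the same color. A matching is a set of pairwise vertex-disjoint edges; it is rainbow if its edges have pairwise distinct colors. -}

module Defs where

open import Data.Nat using (ℕ)
open import Data.Fin using (Fin)
open import Data.Product using (_×_; _,_; proj₁; proj₂; ∃)
open import Data.Sum using (_⊎_)
open import Relation.Binary.PropositionalEquality using (_≡_; _≢_)
open import Relation.Nullary using (¬_)
open import Function.Definitions using (Injective)
open import Data.Integer using (+_)
open import Data.Rational using (ℚ; _/_)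

-- An edge is an (unordered) pair of vertices, stored as an ordered pair.
Edge : ℕ → Set
Edge n = Fin n × Fin n

SameEdge : ∀ {n} → Edge n → Edge n → Set
SameEdge (a , b) (c , d) = (a ≡ c × b ≡ d) ⊎ (a ≡ d × b ≡ c)

ShareVertex : ∀ {n} → Edge n → Edge n → Set
ShareVertex e f =
  (proj₁ e ≡ proj₁ f) ⊎ (proj₁ e ≡ proj₂ f) ⊎ (proj₂ e ≡ proj₁ f) ⊎ (proj₂ e ≡ proj₂ f)

record SimpleGraph (n m : ℕ) : Set where
  field
    edge      : Fin m → Edge n
    loopless  : ∀ i → proj₁ (edge i) ≢ proj₂ (edge i)
    noMulti   : ∀ i j → SameEdge (edge i) (edge j) → i ≡ j
open SimpleGraph public

IsProperColouring : ∀ {n m k} → SimpleGraph n m → (Fin m → Fin k) → Set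
IsProperColouring G col =
  ∀ i j → i ≢ j → ShareVertex (edge G i) (edge G j) → col i ≢ col j

AppearsAtLeast : ∀ {m k} → (Fin m → Fin k) → ℕ → Fin k → Set
AppearsAtLeast {m} col q c =
  ∃ λ (f : Fin q → Fin m) → Injective _≡_ _≡_ f × (∀ t → col (f t) ≡ c)

HasRainbowMatching : ∀ {n m k} → SimpleGraph n m → (Fin m → Fin k) → ℕ → Set
HasRainbowMatching {m = m} G col q =
  ∃ λ (f : Fin q → Fin m) →
    (∀ s t → s ≢ t → ¬ ShareVertex (edge G (f s)) (edge G (f t)))
    × Injective _≡_ _≡_ (λ t → col (f t))

ℕtoℚ : ℕ → ℚ
ℕtoℚ k = + k / 1

-- Let f be a rainbow matching of size s < q, and U its unused colours.  Grow a chain of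
-- matching edges x y such that x has many darts of "free" colours to vertices that are
-- already freeable: those outside the matching (initially) and the ends y of earlier
-- links.  A freeable vertex can be uncovered by boundedly many exchanges, with plenty of
-- choice at every step, so a further edge of free colour between two freeable vertices
-- enlarges the matching.  Assume that the chain cannot be extended.  Each free colour has
-- at least q − |chain| edges avoiding the ends x of the chain, and almost all of them lie
-- inside the set C of ends of the remaining matching edges.  For the colours of U this
-- gives almost every vertex of C a U-degree above |C|/2 within C, and then the colour of
-- almost every matching edge in C can be freed by rotating it with two other matching
-- edges through three edges of colours in U.  Hence almost all of the 2(1+ε)q colours
-- (up to |chain| many) are free, and their edges inside C are too many for the
-- |C| ≤ 2(s − |chain|) vertices of C.

module Submission where

open import Defs
open import Data.Nat using (ℕ; _≥_)
open import Data.Fin using (Fin)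
open import Data.Product using (∃; _,_)

-- The exchanges of one augmentation must not disturb one another, so each choice has to be possible
-- away from any prescribed B vertices and colours. In a simple, properly coloured graph a forbidden
-- vertex or colour costs each vertex at most one dart, so a degree above B is enough. The obstacle
-- is that B must not grow with q, whereas a chain may have order of q links. Hence exits skip the w
-- preceding links: a sequence of exchanges has about q/w steps at most, a number depending only on
-- the denominator K of ε. As w has order q/K², it exceeds B once q is large. When no chain extends,
-- a vertex of C has at most 2w darts of the current palette to freeable vertices. That loss is
-- small compared with e, which has order q/K and is the integer substitute for εq. Since |C|/2 is
-- below q, only few vertices can fall short of |C|/2 + e.

module RainbowMatchings where
  open import Data.Bool using (Bool; true; false; not)
  import Data.Bool.Properties as Bool
  open import Data.Empty using (⊥; ⊥-elim)
  open import Data.Fin using (zero; suc)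
  open import Data.Fin.Properties using (_≟_; suc-injective; all?)
  open import Data.List using (List; []; _∷_; _++_; map; length; filter; allFin; cartesianProduct; take; drop)
  open import Data.List.Membership.DecPropositional as Dec∈ using ()
  open import Data.List.Membership.Propositional using (_∈_; _∉_; find; lose)
  open import Data.List.Membership.Propositional.Properties
  open import Data.List.Properties using (length-map; length-++; length-tabulate; length-take; length-drop; take++drop≡id)
  open import Data.List.Relation.Unary.All as All using (All; []; _∷_)
  open import Data.List.Relation.Unary.AllPairs using ([]; _∷_)
  open import Data.List.Relation.Unary.Any using (Any; here; there; any?)
  open import Data.List.Relation.Unary.Unique.Propositional using (Unique)
  import Data.List.Relation.Unary.Unique.Propositional.Properties as Unique
  open import Data.Maybe using (Maybe; just; nothing)
  open import Data.Maybe.Properties using (just-injective)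
  open import Data.Nat using (zero; suc; _+_; _*_; _≤_; _<_; z≤n; s≤s; s≤s⁻¹; _≤?_; _<?_; NonZero; >-nonZero; >-nonZero⁻¹)
  open import Data.Nat.DivMod using (_/_; _%_; m≡m%n+[m/n]*n; m%n<n; m*n/n≡m; /-monoˡ-≤; m/n*n≤m)
  open import Data.Nat.Properties hiding (_≟_; suc-injective)
  open import Data.Nat.Tactic.RingSolver using (solve-∀)
  open import Data.Product using (_×_; proj₁; proj₂)
  open import Data.Sum using (_⊎_; inj₁; inj₂)
  import Data.Sum.Properties as Sum
  open import Function using (_∘_)
  open import Function.Definitions using (Injective)
  open import Relation.Binary.PropositionalEquality
  open import Relation.Nullary using (¬_; Dec; yes; no)
  open import Relation.Nullary.Decidable using (_×-dec_; _⊎-dec_; ¬?; decidable-stable)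

  -- Sums over lists and counting by indicators

  module Counting where
    private variable
      A B : Set

    ∑ : List A → (A → ℕ) → ℕ
    ∑ []       f = 0
    ∑ (x ∷ xs) f = f x + ∑ xs f

    ⟦_⟧ : {P : Set} → Dec P → ℕ
    ⟦ yes _ ⟧ = 1
    ⟦ no  _ ⟧ = 0

    ⟦⟧≤1 : {P : Set} (p : Dec P) → ⟦ p ⟧ ≤ 1
    ⟦⟧≤1 (yes _) = ≤-refl
    ⟦⟧≤1 (no  _) = z≤n

    ⟦⟧-true : {P : Set} (p : Dec P) → P → ⟦ p ⟧ ≡ 1
    ⟦⟧-true (yes _) _ = refl
    ⟦⟧-true (no ¬x) x = ⊥-elim (¬x x)

    ⟦⟧-positive : {P : Set} (p : Dec P) → 0 < ⟦ p ⟧ → P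
    ⟦⟧-positive (yes x) _ = x

    ⟦⟧-bound : {P : Set} (p : Dec P) {c : ℕ} → (P → 1 ≤ c) → ⟦ p ⟧ ≤ c
    ⟦⟧-bound (yes x) h = h x
    ⟦⟧-bound (no  _) h = z≤n

    ∑-mono : (xs : List A) {f g : A → ℕ} → (∀ x → f x ≤ g x) → ∑ xs f ≤ ∑ xs g
    ∑-mono []       h = z≤n
    ∑-mono (x ∷ xs) h = +-mono-≤ (h x) (∑-mono xs h)

    ∑-mono-∈ : (xs : List A) {f g : A → ℕ} → (∀ x → x ∈ xs → f x ≤ g x) → ∑ xs f ≤ ∑ xs g
    ∑-mono-∈ []       h = z≤n
    ∑-mono-∈ (x ∷ xs) h = +-mono-≤ (h x (here refl)) (∑-mono-∈ xs (λ y y∈ → h y (there y∈)))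

    ∑-cong : (xs : List A) {f g : A → ℕ} → (∀ x → f x ≡ g x) → ∑ xs f ≡ ∑ xs g
    ∑-cong []       h = refl
    ∑-cong (x ∷ xs) h = cong₂ _+_ (h x) (∑-cong xs h)

    ∑-+ : (xs : List A) (f g : A → ℕ) → ∑ xs (λ x → f x + g x) ≡ ∑ xs f + ∑ xs g
    ∑-+ []       f g = refl
    ∑-+ (x ∷ xs) f g = begin
      (f x + g x) + ∑ xs (λ y → f y + g y) ≡⟨ cong (f x + g x +_) (∑-+ xs f g) ⟩
      (f x + g x) + (∑ xs f + ∑ xs g)      ≡⟨ +-assoc (f x) (g x) _ ⟩
      f x + (g x + (∑ xs f + ∑ xs g))      ≡⟨ cong (f x +_) (+-assoc (g x) _ _) ⟨
      f x + ((g x + ∑ xs f) + ∑ xs g)      ≡⟨ cong (λ z → f x + (z + ∑ xs g)) (+-comm (g x) _) ⟩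
      f x + ((∑ xs f + g x) + ∑ xs g)      ≡⟨ cong (f x +_) (+-assoc (∑ xs f) (g x) (∑ xs g)) ⟩
      f x + (∑ xs f + (g x + ∑ xs g))      ≡⟨ +-assoc (f x) _ _ ⟨
      (f x + ∑ xs f) + (g x + ∑ xs g)      ∎
      where open ≡-Reasoning

    ∑-*ˡ : (xs : List A) (c : ℕ) (f : A → ℕ) → ∑ xs (λ x → c * f x) ≡ c * ∑ xs f
    ∑-*ˡ []       c f = sym (*-zeroʳ c)
    ∑-*ˡ (x ∷ xs) c f = trans (cong (c * f x +_) (∑-*ˡ xs c f)) (sym (*-distribˡ-+ c (f x) _))

    ∑-const : (xs : List A) (c : ℕ) → ∑ xs (λ _ → c) ≡ length xs * c
    ∑-const []       c = refl
    ∑-const (x ∷ xs) c = cong (c +_) (∑-const xs c)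

    ∑-0 : (xs : List A) → ∑ xs (λ _ → 0) ≡ 0
    ∑-0 xs = trans (∑-const xs 0) (*-zeroʳ (length xs))

    ∑-≤-const : (xs : List A) {f : A → ℕ} (c : ℕ) → (∀ x → x ∈ xs → f x ≤ c) → ∑ xs f ≤ length xs * c
    ∑-≤-const xs c h = ≤-trans (∑-mono-∈ xs h) (≤-reflexive (∑-const xs c))

    ∑-≤-length : (xs : List A) {f : A → ℕ} → (∀ x → x ∈ xs → f x ≤ 1) → ∑ xs f ≤ length xs
    ∑-≤-length xs h = ≤-trans (∑-≤-const xs 1 h) (≤-reflexive (*-identityʳ _))

    ∑-swap : (xs : List A) (ys : List B) (f : A → B → ℕ) →
             ∑ xs (λ x → ∑ ys (f x)) ≡ ∑ ys (λ y → ∑ xs (λ x → f x y))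
    ∑-swap []       ys f = sym (∑-0 ys)
    ∑-swap (x ∷ xs) ys f = trans (cong (∑ ys (f x) +_) (∑-swap xs ys f)) (sym (∑-+ ys (f x) _))

    ∑-term : (xs : List A) (f : A → ℕ) {x : A} → x ∈ xs → f x ≤ ∑ xs f
    ∑-term (x ∷ xs) f (here refl) = m≤m+n (f x) _
    ∑-term (x ∷ xs) f (there x∈) = ≤-trans (∑-term xs f x∈) (m≤n+m _ (f x))

    ∑-<⇒∃ : (xs : List A) (f g : A → ℕ) → ∑ xs g < ∑ xs f → ∃ λ x → x ∈ xs × g x < f x
    ∑-<⇒∃ (x ∷ xs) f g lt with g x <? f x
    ... | yes p = x , here refl , p
    ... | no ¬p with y , y∈ , q ← ∑-<⇒∃ xs f g
                     (+-cancelˡ-< (g x) _ _ (<-≤-trans lt (+-monoˡ-≤ (∑ xs f) (≮⇒≥ ¬p))))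
      = y , there y∈ , q

    -- Every uniqueness argument below enters a count in this form, with f the indicator of a
    -- property that determines its element.
    ∑-atMostOne : {xs : List A} → Unique xs → {f : A → ℕ} → (∀ x → f x ≤ 1) →
                  (∀ {x y} → x ∈ xs → y ∈ xs → 0 < f x → 0 < f y → x ≡ y) → ∑ xs f ≤ 1
    ∑-atMostOne [] f≤1 h = z≤n
    ∑-atMostOne {xs = x ∷ xs} (x∉ ∷ u) {f} f≤1 h with f x in eq
    ... | zero  = ∑-atMostOne u f≤1 (λ p q → h (there p) (there q))
    ... | suc a = ≤-trans (+-mono-≤ (subst (_≤ 1) eq (f≤1 x)) rest) (≤-reflexive (+-identityʳ 1))
      where
      vanish : ∀ y → y ∈ xs → f y ≤ 0
      vanish y y∈ with f y in eq′
      ... | zero  = z≤n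
      ... | suc _ = ⊥-elim (All.lookup x∉ y∈
                      (h (here refl) (there y∈) (subst (0 <_) (sym eq) (s≤s z≤n)) (subst (0 <_) (sym eq′) (s≤s z≤n))))
      rest : ∑ xs f ≤ 0
      rest = ≤-trans (∑-≤-const xs 0 vanish) (≤-reflexive (*-zeroʳ (length xs)))

    length-filter-∑ : {P : A → Set} (P? : ∀ x → Dec (P x)) (xs : List A) →
                      length (filter P? xs) ≡ ∑ xs (λ x → ⟦ P? x ⟧)
    length-filter-∑ P? [] = refl
    length-filter-∑ P? (x ∷ xs) with P? x
    ... | yes _ = cong suc (length-filter-∑ P? xs)
    ... | no  _ = length-filter-∑ P? xs

    ∑-map : (g : B → A) (xs : List B) (f : A → ℕ) → ∑ (map g xs) f ≡ ∑ xs (f ∘ g)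
    ∑-map g []       f = refl
    ∑-map g (x ∷ xs) f = cong (f (g x) +_) (∑-map g xs f)

    ∑-++ : (xs ys : List A) (f : A → ℕ) → ∑ (xs ++ ys) f ≡ ∑ xs f + ∑ ys f
    ∑-++ []       ys f = refl
    ∑-++ (x ∷ xs) ys f = trans (cong (f x +_) (∑-++ xs ys f)) (sym (+-assoc (f x) _ _))

  open Counting

  -- Oriented edges of a properly coloured simple graph

  module Darts {n m k : ℕ} (G : SimpleGraph n m) (col : Fin m → Fin k)
               (proper : IsProperColouring G col) where

    Dart : Set
    Dart = Fin m × Bool

    -- Vertices and colours which an exchange may be asked to avoid.
    Item : Set
    Item = Fin n ⊎ Fin k

    rev : Dart → Dart
    rev (z , o) = z , not o

    src tgt : Dart → Fin n
    src (z , true)  = proj₁ (edge G z)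
    src (z , false) = proj₂ (edge G z)
    tgt d = src (rev d)

    colour : Dart → Fin k
    colour d = col (proj₁ d)

    rev-involutive : ∀ d → rev (rev d) ≡ d
    rev-involutive (z , true)  = refl
    rev-involutive (z , false) = refl

    src≢tgt : ∀ d → src d ≢ tgt d
    src≢tgt (z , true)  p = loopless G z p
    src≢tgt (z , false) p = loopless G z (sym p)

    sameEdge-dart : ∀ {z z′ o o′} → src (z , o) ≡ src (z′ , o′) → z ≡ z′ → (z , o) ≡ (z′ , o′)
    sameEdge-dart {o = true}  {true}  p refl = refl
    sameEdge-dart {o = true}  {false} p refl = ⊥-elim (loopless G _ p)
    sameEdge-dart {o = false} {true}  p refl = ⊥-elim (loopless G _ (sym p))
    sameEdge-dart {o = false} {false} p refl = refl

    dart-unique-ends : ∀ {d d′} → src d ≡ src d′ → tgt d ≡ tgt d′ → d ≡ d′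
    dart-unique-ends {z , o} {z′ , o′} p q = sameEdge-dart p (same o o′ p q)
      where
      same : ∀ o o′ → src (z , o) ≡ src (z′ , o′) → tgt (z , o) ≡ tgt (z′ , o′) → z ≡ z′
      same true  true  p q = noMulti G z z′ (inj₁ (p , q))
      same true  false p q = noMulti G z z′ (inj₂ (p , q))
      same false true  p q = noMulti G z z′ (inj₂ (q , p))
      same false false p q = noMulti G z z′ (inj₁ (q , p))

    share : ∀ {z z′} o o′ → src (z , o) ≡ src (z′ , o′) → ShareVertex (edge G z) (edge G z′)
    share true  true  p = inj₁ p
    share true  false p = inj₂ (inj₁ p)
    share false true  p = inj₂ (inj₂ (inj₁ p))
    share false false p = inj₂ (inj₂ (inj₂ p))

    dart-unique-colour : ∀ {d d′} → src d ≡ src d′ → colour d ≡ colour d′ → d ≡ d′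
    dart-unique-colour {z , o} {z′ , o′} p c with z ≟ z′
    ... | yes q = sameEdge-dart p q
    ... | no ¬q = ⊥-elim (proper z z′ ¬q (share o o′ p) c)

    dart-unique-colourᵗ : ∀ {d d′} → tgt d ≡ tgt d′ → colour d ≡ colour d′ → d ≡ d′
    dart-unique-colourᵗ {d} {d′} p c =
      trans (sym (rev-involutive d)) (trans (cong rev (dart-unique-colour {rev d} {rev d′} p c)) (rev-involutive d′))

    Disjoint : Fin m → Fin m → Set
    Disjoint z z′ = ∀ o o′ → src (z , o) ≢ src (z′ , o′)

    disjoint⇒¬share : ∀ {z z′} → Disjoint z z′ → ¬ ShareVertex (edge G z) (edge G z′)
    disjoint⇒¬share h (inj₁ p)               = h true true p
    disjoint⇒¬share h (inj₂ (inj₁ p))        = h true false p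
    disjoint⇒¬share h (inj₂ (inj₂ (inj₁ p))) = h false true p
    disjoint⇒¬share h (inj₂ (inj₂ (inj₂ p))) = h false false p

    ¬share⇒disjoint : ∀ {z z′} → ¬ ShareVertex (edge G z) (edge G z′) → Disjoint z z′
    ¬share⇒disjoint h o o′ p = h (share o o′ p)

    -- Colours and vertices that can be freed

    module Augmentation {s : ℕ} (f : Fin s → Fin m)
      (disj : ∀ {i j} → i ≢ j → Disjoint (f i) (f j))
      (rain : Injective _≡_ _≡_ (λ i → col (f i))) (B : ℕ) where

      MDart : Set
      MDart = Fin s × Bool

      flip : MDart → MDart
      flip (i , o) = i , not o

      srcᴹ tgtᴹ : MDart → Fin n
      srcᴹ (i , o) = src (f i , o)
      tgtᴹ μ = srcᴹ (flip μ)

      Outside : Fin n → Set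
      Outside v = ∀ μ → srcᴹ μ ≢ v

      Unusedᴹ : Fin k → Set
      Unusedᴹ c = ∀ i → col (f i) ≢ c

      srcᴹ-injective : ∀ {μ ν} → srcᴹ μ ≡ srcᴹ ν → μ ≡ ν
      srcᴹ-injective {i , o} {j , o′} p with i ≟ j
      ... | no i≢j = ⊥-elim (disj i≢j o o′ p)
      ... | yes refl = cong (λ d → i , proj₂ d) (sameEdge-dart {o = o} {o′} p refl)

      -- Three unused colours rotating the matching edges p = xy, μ = x′y′, ν = x″y″
      -- into xx′, y′x″, yy″; this frees the colour of p.
      record Swap (p : Fin s) (F : List Item) : Set where
        field
          μ ν      : MDart
          d₁ d₂ d₃ : Dart
          src₁ : src d₁ ≡ srcᴹ (p , true)
          tgt₁ : tgt d₁ ≡ srcᴹ μ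
          src₂ : src d₂ ≡ tgtᴹ μ
          tgt₂ : tgt d₂ ≡ srcᴹ ν
          src₃ : src d₃ ≡ srcᴹ (p , false)
          tgt₃ : tgt d₃ ≡ tgtᴹ ν
          μ∉F  : inj₁ (srcᴹ μ) ∉ F
          ν∉F  : inj₁ (srcᴹ ν) ∉ F
          μ≢ν  : proj₁ μ ≢ proj₁ ν
          new₁ : Unusedᴹ (colour d₁) × inj₂ (colour d₁) ∉ F
          new₂ : Unusedᴹ (colour d₂) × inj₂ (colour d₂) ∉ F
          new₃ : Unusedᴹ (colour d₃) × inj₂ (colour d₃) ∉ F
          c₁≢c₂ : colour d₁ ≢ colour d₂
          c₁≢c₃ : colour d₁ ≢ colour d₃
          c₂≢c₃ : colour d₂ ≢ colour d₃

      -- A colour is freed in the middle of a longer exchange, when some edges have already been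
      -- changed; the swap must therefore exist for every list F of at most B items.
      FreeColour : Fin k → Set
      FreeColour c = Unusedᴹ c ⊎ ∃ λ p → col (f p) ≡ c × (∀ F → length F ≤ B → Swap p F)

      data Freeable : ℕ → Fin n → Set
      record Exit (ℓ : ℕ) (x : Fin n) (F : List Item) : Set

      -- A freeable vertex can be uncovered by at most ℓ successive exchanges,
      -- each of which may be chosen away from any B items.
      data Freeable where
        outside : ∀ {ℓ v} → Outside v → Freeable ℓ v
        via     : ∀ {ℓ} ν → (∀ F → length F ≤ B → Exit ℓ (srcᴹ ν) F) → Freeable (suc ℓ) (tgtᴹ ν)

      record Exit ℓ x F where
        inductive
        field
          d      : Dart
          src≡   : src d ≡ x
          tgt∉F  : inj₁ (tgt d) ∉ F
          col∉F  : inj₂ (colour d) ∉ F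
          free   : FreeColour (colour d)
          target : Freeable ℓ (tgt d)

      -- Partial rainbow matchings during an exchange

      Partial : Set
      Partial = Fin (suc s) → Maybe (Fin m)

      Forbidden : List Item → Fin m → Set
      Forbidden F e = (∀ o → inj₁ (src (e , o)) ∈ F) × inj₂ (col e) ∈ F

      -- This all-or-nothing dichotomy makes F a complete record. Either a slot holds its original
      -- edge and F lists no item of it, or the original edge and any present occupant are listed
      -- entirely. A single end or colour of an original edge then decides which case holds.
      Fresh Touched : Partial → List Item → Fin s → Set
      Fresh S F t   = S (suc t) ≡ just (f t) × (∀ o → inj₁ (src (f t , o)) ∉ F) × inj₂ (col (f t)) ∉ F
      Touched S F t = Forbidden F (f t) × (∀ e → S (suc t) ≡ just e → Forbidden F e)

      -- A rainbow matching with suc s slots, slot suc t replacing the edge f t, and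
      -- with the empty slots among H; everything that differs from f is listed in F.
      record State (H : List (Fin (suc s))) : Set where
        field
          S       : Partial
          F       : List Item
          compat  : ∀ {a b e e′} → a ≢ b → S a ≡ just e → S b ≡ just e′ → Disjoint e e′ × col e ≢ col e′
          status  : ∀ t → Fresh S F t ⊎ Touched S F t
          top     : ∀ e → S zero ≡ just e → Forbidden F e
          holes   : ∀ a → S a ≡ nothing → a ∈ H
      open State

      private variable
        H H′ : List (Fin (suc s))

      Uncovered : State H → Fin n → Set
      Uncovered σ v = ∀ a {e} → S σ a ≡ just e → ∀ o → src (e , o) ≢ v

      Unused : State H → Fin k → Set
      Unused σ c = ∀ a {e} → S σ a ≡ just e → col e ≢ c

      _[_≔_] : Partial → Fin (suc s) → Maybe (Fin m) → Partial
      (T [ a ≔ x ]) b with b ≟ a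
      ... | yes _ = x
      ... | no  _ = T b

      items : Fin m → List Item
      items e = inj₁ (src (e , true)) ∷ inj₁ (src (e , false)) ∷ inj₂ (col e) ∷ []

      end∈items : ∀ e o → inj₁ (src (e , o)) ∈ items e
      end∈items e true  = here refl
      end∈items e false = there (here refl)

      forbidden-items : ∀ e F → Forbidden (items e ++ F) e
      forbidden-items e F = (λ { true → here refl ; false → there (here refl) }) , there (there (here refl))

      forbidden-++ : ∀ X {F e} → Forbidden F e → Forbidden (X ++ F) e
      forbidden-++ X (p , q) = (λ o → ∈-++⁺ʳ X (p o)) , ∈-++⁺ʳ X q

      ∉-items-vertex : ∀ {e v F} → (∀ o → src (e , o) ≢ v) → inj₁ v ∉ F → inj₁ v ∉ items e ++ F
      ∉-items-vertex h q (here refl)                 = h true refl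
      ∉-items-vertex h q (there (here refl))         = h false refl
      ∉-items-vertex h q (there (there (there p)))   = q p

      ∉-items-colour : ∀ {e c F} → col e ≢ c → inj₂ c ∉ F → inj₂ c ∉ items e ++ F
      ∉-items-colour h q (there (there (here refl))) = h refl
      ∉-items-colour h q (there (there (there p)))   = q p

      fresh : (σ : State H) → ∀ μ → inj₁ (srcᴹ μ) ∉ F σ → Fresh (S σ) (F σ) (proj₁ μ)
      fresh σ (t , o) v∉F with status σ t
      ... | inj₁ p = p
      ... | inj₂ ((p , _) , _) = ⊥-elim (v∉F (p o))

      touched : (σ : State H) → ∀ μ → inj₁ (srcᴹ μ) ∈ F σ → Touched (S σ) (F σ) (proj₁ μ)
      touched σ (t , o) v∈F with status σ t
      ... | inj₁ (_ , p , _) = ⊥-elim (p o v∈F)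
      ... | inj₂ p = p

      clear : (σ : State H) (j : Fin s) → Fresh (S σ) (F σ) j → State (suc j ∷ H)
      clear {H} σ j (Sj , _ , _) = record
        { S = S′ ; F = F′ ; compat = compat′ ; status = status′ ; top = top′ ; holes = holes′ }
        where
        S′ = S σ [ suc j ≔ nothing ]
        F′ = items (f j) ++ F σ
        old : ∀ {a e} → S′ a ≡ just e → a ≢ suc j × S σ a ≡ just e
        old {a} p with a ≟ suc j
        ... | no q = q , p
        compat′ : ∀ {a b e e′} → a ≢ b → S′ a ≡ just e → S′ b ≡ just e′ → Disjoint e e′ × col e ≢ col e′
        compat′ {a} {b} a≢b p q = compat σ a≢b (proj₂ (old {a} p)) (proj₂ (old {b} q))
        top′ : ∀ e → S′ zero ≡ just e → Forbidden F′ e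
        top′ e p = forbidden-++ (items (f j)) (top σ e (proj₂ (old {zero} p)))
        holes′ : ∀ a → S′ a ≡ nothing → a ∈ suc j ∷ H
        holes′ a p with a ≟ suc j
        ... | yes q = here q
        ... | no  _ = there (holes σ a p)
        kept : ∀ {t} → t ≢ j → S σ (suc t) ≡ just (f t) → S′ (suc t) ≡ just (f t)
        kept {t} t≢j p with suc t ≟ suc j
        ... | yes q = ⊥-elim (t≢j (suc-injective q))
        ... | no  _ = p
        status′ : ∀ t → Fresh S′ F′ t ⊎ Touched S′ F′ t
        status′ t = by-cases (t ≟ j) (status σ t)
          where
          by-cases : Dec (t ≡ j) → Fresh (S σ) (F σ) t ⊎ Touched (S σ) (F σ) t → Fresh S′ F′ t ⊎ Touched S′ F′ t
          by-cases (yes refl) _ = inj₂ (forbidden-items (f t) (F σ) , λ e p → ⊥-elim (proj₁ (old {suc t} p) refl))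
          by-cases (no t≢j) (inj₁ (p , q , r)) =
            inj₁ (kept t≢j p , (λ o → ∉-items-vertex (λ o′ → disj (t≢j ∘ sym) o′ o) (q o))
                 , ∉-items-colour (t≢j ∘ sym ∘ rain) r)
          by-cases (no t≢j) (inj₂ (p , q)) =
            inj₂ (forbidden-++ (items (f j)) p , λ e r → forbidden-++ (items (f j)) (q e (proj₂ (old {suc t} r))))

      module _ (σ : State H) (j : Fin s) (fr : Fresh (S σ) (F σ) j) where
        clear-old : ∀ {a e} → S (clear σ j fr) a ≡ just e → a ≢ suc j × S σ a ≡ just e
        clear-old {a} p with a ≟ suc j
        ... | no q = q , p

        clear-uncovered : ∀ {v} → Uncovered σ v → Uncovered (clear σ j fr) v
        clear-uncovered h a p = h a (proj₂ (clear-old {a} p))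

        clear-unused : ∀ {c} → Unused σ c → Unused (clear σ j fr) c
        clear-unused h a p = h a (proj₂ (clear-old {a} p))

        clear-end : ∀ o → Uncovered (clear σ j fr) (srcᴹ (j , o))
        clear-end o a p o′ = proj₁ (compat σ (proj₁ (clear-old {a} p)) (proj₂ (clear-old {a} p)) (proj₁ fr)) o′ o

        clear-colour : Unused (clear σ j fr) (col (f j))
        clear-colour a p = proj₂ (compat σ (proj₁ (clear-old {a} p)) (proj₂ (clear-old {a} p)) (proj₁ fr))

      -- A slot with a new occupant is no longer fresh, so its original edge must already be listed
      -- in F. Slot `zero` has no original edge and is always replaceable.
      Replaceable : State H → Fin (suc s) → Set
      Replaceable σ a = ∀ t → a ≡ suc t → Touched (S σ) (F σ) t

      place : (σ : State H) (a : Fin (suc s)) → Replaceable σ a → (∀ {b} → b ∈ H → b ≡ a ⊎ b ∈ H′) →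
              (e : Fin m) → (∀ o → Uncovered σ (src (e , o))) → Unused σ (col e) → State H′
      place {H} {H′} σ a rep hs e unc unu = record
        { S = S′ ; F = F′ ; compat = compat′ ; status = status′ ; top = top′ ; holes = holes′ }
        where
        S′ = S σ [ a ≔ just e ]
        F′ = items e ++ F σ
        old : ∀ {b e′} → S′ b ≡ just e′ → (b ≡ a × e ≡ e′) ⊎ (b ≢ a × S σ b ≡ just e′)
        old {b} p with b ≟ a
        ... | yes q = inj₁ (q , just-injective p)
        ... | no  q = inj₂ (q , p)
        compat′ : ∀ {b b′ x x′} → b ≢ b′ → S′ b ≡ just x → S′ b′ ≡ just x′ → Disjoint x x′ × col x ≢ col x′
        compat′ {b} {b′} b≢b′ p q with old {b} p | old {b′} q
        ... | inj₁ (refl , refl) | inj₁ (refl , refl) = ⊥-elim (b≢b′ refl)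
        ... | inj₁ (refl , refl) | inj₂ (_ , r)       = (λ o o′ → ≢-sym (unc o b′ r o′)) , ≢-sym (unu b′ r)
        ... | inj₂ (_ , r)       | inj₁ (refl , refl) = (λ o o′ → unc o′ b r o) , unu b r
        ... | inj₂ (_ , r)       | inj₂ (_ , r′)      = compat σ b≢b′ r r′
        forb : ∀ b {e′} → (S σ b ≡ just e′ → Forbidden (F σ) e′) → S′ b ≡ just e′ → Forbidden F′ e′
        forb b h p with old {b} p
        ... | inj₁ (_ , refl) = forbidden-items e (F σ)
        ... | inj₂ (_ , r)    = forbidden-++ (items e) (h r)
        top′ : ∀ e′ → S′ zero ≡ just e′ → Forbidden F′ e′
        top′ e′ = forb zero (top σ e′)
        holes′ : ∀ b → S′ b ≡ nothing → b ∈ H′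
        holes′ b p with b ≟ a
        ... | no q with hs (holes σ b p)
        ... | inj₁ r = ⊥-elim (q r)
        ... | inj₂ r = r
        kept : ∀ {b} → b ≢ a → S′ b ≡ S σ b
        kept {b} b≢a with b ≟ a
        ... | yes q = ⊥-elim (b≢a q)
        ... | no  _ = refl
        status-touched : ∀ t → Touched (S σ) (F σ) t → Touched S′ F′ t
        status-touched t (p , q) = forbidden-++ (items e) p , λ e′ → forb (suc t) (q e′)
        status′ : ∀ t → Fresh S′ F′ t ⊎ Touched S′ F′ t
        status′ t = by-cases (suc t ≟ a) (status σ t)
          where
          by-cases : Dec (suc t ≡ a) → Fresh (S σ) (F σ) t ⊎ Touched (S σ) (F σ) t → Fresh S′ F′ t ⊎ Touched S′ F′ t
          by-cases (yes q) _ = inj₂ (status-touched t (rep t (sym q)))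
          by-cases (no t≢a) (inj₂ p) = inj₂ (status-touched t p)
          by-cases (no t≢a) (inj₁ (p , q , r)) =
            inj₁ (trans (kept t≢a) p , (λ o → ∉-items-vertex (λ o′ → ≢-sym (unc o′ (suc t) p o)) (q o))
                 , ∉-items-colour (≢-sym (unu (suc t) p)) r)

      module _ (σ : State H) (a : Fin (suc s)) (rep : Replaceable σ a)
               (hs : ∀ {b} → b ∈ H → b ≡ a ⊎ b ∈ H′) (e : Fin m)
               (unc : ∀ o → Uncovered σ (src (e , o))) (unu : Unused σ (col e)) where
        place-old : ∀ {b e′} → S (place {H′ = H′} σ a rep hs e unc unu) b ≡ just e′ → e ≡ e′ ⊎ S σ b ≡ just e′
        place-old {b} p with b ≟ a
        ... | yes q = inj₁ (just-injective p)
        ... | no  q = inj₂ p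

        place-uncovered : ∀ {v} → (∀ o → src (e , o) ≢ v) → Uncovered σ v →
                          Uncovered (place {H′ = H′} σ a rep hs e unc unu) v
        place-uncovered v∉e h b p o with place-old {b} p
        ... | inj₁ refl = v∉e o
        ... | inj₂ q    = h b q o

        place-unused : ∀ {c} → col e ≢ c → Unused σ c → Unused (place {H′ = H′} σ a rep hs e unc unu) c
        place-unused c≢ h b p with place-old {b} p
        ... | inj₁ refl = c≢
        ... | inj₂ q    = h b q

      -- The counterpart of `clear` for a vertex with no matching edge: listing it in F protects it
      -- from all later choices.
      reserve : State H → (v : Fin n) → Outside v → State H
      reserve {H} σ v out = record
        { S = S σ ; F = inj₁ v ∷ F σ ; compat = compat σ ; status = status′
        ; top = λ e p → forbidden-++ (_ ∷ []) (top σ e p) ; holes = holes σ }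
        where
        status′ : ∀ t → Fresh (S σ) (inj₁ v ∷ F σ) t ⊎ Touched (S σ) (inj₁ v ∷ F σ) t
        status′ t with status σ t
        ... | inj₁ (p , q , r) = inj₁ (p , (λ { o (here refl) → out (t , o) refl ; o (there x) → q o x })
                                      , λ { (there x) → r x })
        ... | inj₂ (p , q) = inj₂ (forbidden-++ (_ ∷ []) p , λ e x → forbidden-++ (_ ∷ []) (q e x))

      fresh-colour : (σ : State H) → ∀ p → inj₂ (col (f p)) ∉ F σ → Fresh (S σ) (F σ) p
      fresh-colour σ p c∉F with status σ p
      ... | inj₁ q = q
      ... | inj₂ ((_ , q) , _) = ⊥-elim (c∉F q)

      uncovered-outside : (σ : State H) {v : Fin n} → Outside v → inj₁ v ∉ F σ → Uncovered σ v
      uncovered-outside σ out v∉F zero p o refl = v∉F (proj₁ (top σ _ p) o)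
      uncovered-outside σ out v∉F (suc t) p o refl with status σ t
      ... | inj₁ (q , _) with refl ← just-injective (trans (sym p) q) = out (t , o) refl
      ... | inj₂ (_ , q) = v∉F (proj₁ (q _ p) o)

      unused-new : (σ : State H) {c : Fin k} → Unusedᴹ c → inj₂ c ∉ F σ → Unused σ c
      unused-new σ new c∉F zero p refl = c∉F (proj₂ (top σ _ p))
      unused-new σ new c∉F (suc t) p refl with status σ t
      ... | inj₁ (q , _) with refl ← just-injective (trans (sym p) q) = new t refl
      ... | inj₂ (_ , q) = c∉F (proj₂ (q _ p))

      -- Freeing a colour by a swap

      both-ends : (P : Fin n → Set) (d : Dart) → P (src d) → P (tgt d) → ∀ o → P (src (proj₁ d , o))
      both-ends P (z , true)  p q true  = p
      both-ends P (z , true)  p q false = q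
      both-ends P (z , false) p q true  = q
      both-ends P (z , false) p q false = p

      ∉∈⇒≢ : {F : List Item} → ∀ {u v} → inj₁ u ∉ F → inj₁ v ∈ F → u ≢ v
      ∉∈⇒≢ u∉ v∈ refl = u∉ v∈

      apartᴹ : ∀ μ ν → proj₁ μ ≢ proj₁ ν → srcᴹ μ ≢ srcᴹ ν
      apartᴹ (i , o) (j , o′) i≢j = disj i≢j o o′

      -- Only vertices listed in F are promised to stay uncovered, because only those are avoided by
      -- the new edges of a swap. The 18 counts three items for each of three cleared and three
      -- placed edges.
      record Acquired (σ : State H) (c : Fin k) : Set where
        field
          τ      : State H
          grow   : ∀ {x} → x ∈ F σ → x ∈ F τ
          keep   : ∀ {v} → inj₁ v ∈ F σ → Uncovered σ v → Uncovered τ v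
          unused : Unused τ c
          size   : length (F τ) ≤ 18 + length (F σ)

      module _ (σ : State H) (p : Fin s) (frₚ : Fresh (S σ) (F σ) p)
               (sw : Swap p (items (f p) ++ F σ)) where
        open Swap sw
        private
          iμ iν : Fin s
          p₊ p₋ : MDart
          p₊ = p , true
          p₋ = p , false
          iμ = proj₁ μ
          iν = proj₁ ν

          F₁ = items (f p) ++ F σ
          σ₁ = clear σ p frₚ
          frμ = fresh σ₁ μ μ∉F
          σ₂ = clear σ₁ iμ frμ

          ν∉F₂ : inj₁ (srcᴹ ν) ∉ F σ₂
          ν∉F₂ = ∉-items-vertex (λ o → apartᴹ (iμ , o) ν μ≢ν) ν∉F

          frν = fresh σ₂ ν ν∉F₂
          σ₃ = clear σ₂ iν frν

          μ≢p : iμ ≢ p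
          μ≢p q = μ∉F (subst (λ i → inj₁ (srcᴹ (iμ , proj₂ μ)) ∈ items (f i) ++ F σ) q
                     (proj₁ (forbidden-items (f iμ) (F σ)) (proj₂ μ)))
          ν≢p : iν ≢ p
          ν≢p q = ν∉F (subst (λ i → inj₁ (srcᴹ (iν , proj₂ ν)) ∈ items (f i) ++ F σ) q
                     (proj₁ (forbidden-items (f iν) (F σ)) (proj₂ ν)))

          clear₃ : ∀ {v} → Uncovered σ v → Uncovered σ₃ v
          clear₃ h = clear-uncovered σ₂ iν frν (clear-uncovered σ₁ iμ frμ (clear-uncovered σ p frₚ h))

          p-free : ∀ o → Uncovered σ₃ (srcᴹ (p , o))
          p-free o = clear-uncovered σ₂ iν frν (clear-uncovered σ₁ iμ frμ (clear-end σ p frₚ o))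
          μ-free : ∀ o → Uncovered σ₃ (srcᴹ (iμ , o))
          μ-free o = clear-uncovered σ₂ iν frν (clear-end σ₁ iμ frμ o)
          ν-free : ∀ o → Uncovered σ₃ (srcᴹ (iν , o))
          ν-free o = clear-end σ₂ iν frν o

          new : ∀ {c} → Unusedᴹ c × inj₂ c ∉ F₁ → Unused σ₃ c
          new (h , q) = clear-unused σ₂ iν frν (clear-unused σ₁ iμ frμ (unused-new σ₁ h q))

          c-unused : Unused σ₃ (col (f p))
          c-unused = clear-unused σ₂ iν frν (clear-unused σ₁ iμ frμ (clear-colour σ p frₚ))

          avoid : ∀ d {u v w} → src d ≡ u → tgt d ≡ v → u ≢ w → v ≢ w → ∀ o → src (proj₁ d , o) ≢ w
          avoid d {w = w} refl refl = both-ends (_≢ w) d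

          free : ∀ {H} (ρ : State H) d {u v} → src d ≡ u → tgt d ≡ v → Uncovered ρ u → Uncovered ρ v →
                 ∀ o → Uncovered ρ (src (proj₁ d , o))
          free ρ d refl refl = both-ends (Uncovered ρ) d

          pop : ∀ {A : Set} {x b : A} {xs} → b ∈ x ∷ xs → b ≡ x ⊎ b ∈ xs
          pop (here q)  = inj₁ q
          pop (there q) = inj₂ q

          replace : ∀ {H} (ρ : State H) i o → inj₁ (srcᴹ (i , o)) ∈ F ρ → Replaceable ρ (suc i)
          replace ρ i o q t refl = touched ρ (i , o) q

          -- All three edges are cleared before any is placed, since each new edge joins ends of two
          -- of them. Refilling in the reverse order of clearing keeps the hole to be filled at the
          -- head of the list.
          rep₃ : Replaceable σ₃ (suc iν)
          rep₃ = replace σ₃ iν true (proj₁ (forbidden-items (f iν) (F σ₂)) true)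
          unc₃ = free σ₃ d₃ src₃ tgt₃ (p-free false) (ν-free (not (proj₂ ν)))
          σ₄ : State (suc iμ ∷ suc p ∷ H)
          σ₄ = place σ₃ (suc iν) rep₃ pop (proj₁ d₃) unc₃ (new new₃)
          step₃ : ∀ {v} → srcᴹ (p , false) ≢ v → tgtᴹ ν ≢ v → Uncovered σ₃ v → Uncovered σ₄ v
          step₃ a b = place-uncovered σ₃ (suc iν) rep₃ pop (proj₁ d₃) unc₃ (new new₃)
                        (avoid d₃ src₃ tgt₃ a b)
          unused₃ : ∀ {c} → colour d₃ ≢ c → Unused σ₃ c → Unused σ₄ c
          unused₃ = place-unused σ₃ (suc iν) rep₃ pop (proj₁ d₃) unc₃ (new new₃)

          rep₂ : Replaceable σ₄ (suc iμ)
          rep₂ = replace σ₄ iμ true (∈-++⁺ʳ (items (proj₁ d₃)) (∈-++⁺ʳ (items (f iν))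
                   (proj₁ (forbidden-items (f iμ) (F σ₁)) true)))
          unc₂ = free σ₄ d₂ src₂ tgt₂
                   (step₃ (apartᴹ p₋ (flip μ) (≢-sym μ≢p)) (apartᴹ (flip ν) (flip μ) (≢-sym μ≢ν)) (μ-free (not (proj₂ μ))))
                   (step₃ (apartᴹ p₋ ν (≢-sym ν≢p)) (≢-sym (src≢tgt (f iν , proj₂ ν))) (ν-free (proj₂ ν)))
          unu₂ = unused₃ (≢-sym c₂≢c₃) (new new₂)
          σ₅ : State (suc p ∷ H)
          σ₅ = place σ₄ (suc iμ) rep₂ pop (proj₁ d₂) unc₂ unu₂
          step₂ : ∀ {v} → tgtᴹ μ ≢ v → srcᴹ ν ≢ v → Uncovered σ₄ v → Uncovered σ₅ v
          step₂ a b = place-uncovered σ₄ (suc iμ) rep₂ pop (proj₁ d₂) unc₂ unu₂ (avoid d₂ src₂ tgt₂ a b)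
          unused₂ : ∀ {c} → colour d₂ ≢ c → Unused σ₄ c → Unused σ₅ c
          unused₂ = place-unused σ₄ (suc iμ) rep₂ pop (proj₁ d₂) unc₂ unu₂

          rep₁ : Replaceable σ₅ (suc p)
          rep₁ = replace σ₅ p true (∈-++⁺ʳ (items (proj₁ d₂)) (∈-++⁺ʳ (items (proj₁ d₃)) (∈-++⁺ʳ (items (f iν))
                   (∈-++⁺ʳ (items (f iμ)) (proj₁ (forbidden-items (f p) (F σ)) true)))))
          unc₁ = free σ₅ d₁ src₁ tgt₁
                   (step₂ (apartᴹ (flip μ) p₊ μ≢p) (apartᴹ ν p₊ ν≢p)
                     (step₃ (src≢tgt (f p , false)) (apartᴹ (flip ν) p₊ ν≢p) (p-free true)))
                   (step₂ (≢-sym (src≢tgt (f iμ , proj₂ μ))) (apartᴹ ν μ (≢-sym μ≢ν))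
                     (step₃ (apartᴹ p₋ μ (≢-sym μ≢p)) (apartᴹ (flip ν) μ (≢-sym μ≢ν)) (μ-free (proj₂ μ))))
          unu₁ = unused₂ (≢-sym c₁≢c₂) (unused₃ (≢-sym c₁≢c₃) (new new₁))
          σ₆ : State H
          σ₆ = place σ₅ (suc p) rep₁ pop (proj₁ d₁) unc₁ unu₁
          step₁ : ∀ {v} → srcᴹ (p , true) ≢ v → srcᴹ μ ≢ v → Uncovered σ₅ v → Uncovered σ₆ v
          step₁ a b = place-uncovered σ₅ (suc p) rep₁ pop (proj₁ d₁) unc₁ unu₁ (avoid d₁ src₁ tgt₁ a b)
          unused₁ : ∀ {c} → colour d₁ ≢ c → Unused σ₅ c → Unused σ₆ c
          unused₁ = place-unused σ₅ (suc p) rep₁ pop (proj₁ d₁) unc₁ unu₁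

          new≢ : ∀ {c} → Unusedᴹ c → c ≢ col (f p)
          new≢ h q = h p (sym q)

          shrink : ∀ {x} → x ∉ F₁ → x ∉ F σ
          shrink h q = h (∈-++⁺ʳ (items (f p)) q)

        apply-swap : Acquired σ (col (f p))
        apply-swap = record
          { τ = σ₆
          ; grow = λ q → ∈-++⁺ʳ (items (proj₁ d₁)) (∈-++⁺ʳ (items (proj₁ d₂)) (∈-++⁺ʳ (items (proj₁ d₃))
                     (∈-++⁺ʳ (items (f iν)) (∈-++⁺ʳ (items (f iμ)) (∈-++⁺ʳ (items (f p)) q)))))
          ; keep = λ v∈ h →
              step₁ (∉∈⇒≢ (proj₁ (proj₂ frₚ) true) v∈) (∉∈⇒≢ (shrink μ∉F) v∈)
                (step₂ (∉∈⇒≢ (shrink (proj₁ (proj₂ frμ) (not (proj₂ μ)))) v∈) (∉∈⇒≢ (shrink ν∉F) v∈)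
                  (step₃ (∉∈⇒≢ (proj₁ (proj₂ frₚ) false) v∈)
                         (∉∈⇒≢ (shrink (proj₁ (proj₂ (fresh σ₁ ν ν∉F)) (not (proj₂ ν)))) v∈)
                    (clear₃ h)))
          ; unused = unused₁ (new≢ (proj₁ new₁)) (unused₂ (new≢ (proj₁ new₂)) (unused₃ (new≢ (proj₁ new₃)) c-unused))
          ; size = ≤-refl
          }

      -- The swap is requested relative to `items (f p) ++ F`, which costs the extra 3 and keeps μ
      -- and ν different from p.
      acquire : (σ : State H) {c : Fin k} → 3 + length (F σ) ≤ B → FreeColour c → inj₂ c ∉ F σ → Acquired σ c
      acquire σ b (inj₁ new) c∉F = record
        { τ = σ ; grow = λ q → q ; keep = λ _ h → h ; unused = unused-new σ new c∉F ; size = m≤n+m _ 18 }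
      acquire σ b (inj₂ (p , refl , swaps)) c∉F = apply-swap σ p (fresh-colour σ p c∉F) (swaps _ b)

      -- Uncovering a freeable vertex and repairing the matching

      edgeᴹ : MDart → Dart
      edgeᴹ (i , o) = f i , o

      private variable
        ℓ : ℕ
        u : Fin n

      slots : Freeable ℓ u → List (Fin (suc s))
      slots (outside _) = []
      slots (via ν _)   = suc (proj₁ ν) ∷ []

      reserved : Freeable ℓ u → List Item
      reserved (outside {v = v} _) = inj₁ v ∷ []
      reserved (via ν _)           = items (f (proj₁ ν))

      -- Clearing the edge ν uncovers its target for use elsewhere; its source is the vertex from
      -- which the slot of ν will be refilled, and must stay uncovered until then.
      Root : Freeable ℓ u → Fin n → Set
      Root (outside _) v = ⊥
      Root (via ν _)   v = srcᴹ ν ≡ v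

      reserved-self : (t : Freeable ℓ u) → inj₁ u ∈ reserved t
      reserved-self (outside _) = here refl
      reserved-self (via ν _)   = end∈items (f (proj₁ ν)) (not (proj₂ ν))

      reserved-root : (t : Freeable ℓ u) → ∀ {v} → Root t v → inj₁ v ∈ reserved t
      reserved-root (via ν _) refl = end∈items (f (proj₁ ν)) (proj₂ ν)

      root≢self : (t : Freeable ℓ u) → ∀ {v} → Root t v → u ≢ v
      root≢self (via ν _) refl = ≢-sym (src≢tgt (edgeᴹ ν))

      Ready : Freeable ℓ u → State H → Set
      Ready t σ = (∀ v → Root t v → Uncovered σ v) × (∀ {x} → x ∈ reserved t → x ∈ F σ)

      root∉F : (σ : State H) (t : Freeable ℓ u) → inj₁ u ∉ F σ → ∀ {v} → Root t v → inj₁ v ∉ F σ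
      root∉F σ (via ν _) u∉F refl = proj₁ (proj₂ (fresh σ (flip ν) u∉F)) (proj₂ ν)

      -- A dart ending in the edge ν and having its colour would be that edge.
      colour∉reserved : ∀ d → (∀ μ → d ≢ edgeᴹ μ) → (t : Freeable ℓ u) → u ≡ tgt d → ∀ {X} → inj₂ (colour d) ∉ X →
                        inj₂ (colour d) ∉ reserved t ++ X
      colour∉reserved d new (outside _) e h (there q) = h q
      colour∉reserved d new (via ν _)   e h q = ∉-items-colour differ h q
        where
        differ : col (f (proj₁ ν)) ≢ colour d
        differ c = new (proj₁ ν , not (not (proj₂ ν)))
          (trans (sym (rev-involutive d)) (cong rev (dart-unique-colour {rev d} {edgeᴹ (flip ν)} (sym e) (sym c))))

      record Secured (σ : State H) (t : Freeable ℓ u) : Set where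
        field
          τ     : State (slots t ++ H)
          F≡    : F τ ≡ reserved t ++ F σ
          keep  : ∀ {v} → Uncovered σ v → Uncovered τ v
          self  : Uncovered τ u
          roots : ∀ v → Root t v → Uncovered τ v
          size  : length (F τ) ≤ 3 + length (F σ)

        grow : ∀ {x} → x ∈ F σ → x ∈ F τ
        grow {x} q = subst (x ∈_) (sym F≡) (∈-++⁺ʳ (reserved t) q)

        shrink : ∀ {x} → x ∈ F τ → x ∈ reserved t ++ F σ
        shrink {x} = subst (x ∈_) F≡

        reserved⊆ : ∀ {x} → x ∈ reserved t → x ∈ F τ
        reserved⊆ {x} q = subst (x ∈_) (sym F≡) (∈-++⁺ˡ q)

      secure : (σ : State H) (t : Freeable ℓ u) → inj₁ u ∉ F σ → Secured σ t
      secure σ (outside {v = v} out) u∉F = record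
        { τ = reserve σ v out ; F≡ = refl ; keep = λ h → h
        ; self = uncovered-outside σ out u∉F ; roots = λ _ () ; size = m≤n+m _ 2 }
      secure σ (via (j , o) _) u∉F = record
        { τ = clear σ j fr ; F≡ = refl ; keep = clear-uncovered σ j fr
        ; self = clear-end σ j fr (not o) ; roots = λ { v refl → clear-end σ j fr o } ; size = ≤-refl }
        where fr = fresh σ (j , not o) u∉F

      -- The root is excepted from `keep` because refilling its slot covers it again.
      record Settled (σ : State (H ++ H′)) (t : Freeable ℓ u) : Set where
        field
          τ    : State H′
          grow : ∀ {x} → x ∈ F σ → x ∈ F τ
          keep : ∀ {v} → inj₁ v ∈ F σ → ¬ Root t v → Uncovered σ v → Uncovered τ v
          size : length (F τ) ≤ ℓ * 24 + length (F σ)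

      drop-middle : ∀ {A : Set} (xs : List A) {ys : List A} {x b : A} → b ∈ xs ++ x ∷ ys → b ≡ x ⊎ b ∈ xs ++ ys
      drop-middle []       (here q)  = inj₁ q
      drop-middle []       (there q) = inj₂ q
      drop-middle (_ ∷ xs) (here q)  = inj₂ (here q)
      drop-middle (_ ∷ xs) (there q) with drop-middle xs q
      ... | inj₁ r = inj₁ r
      ... | inj₂ r = inj₂ (there r)

      -- The source of ν takes an exit dart to another freeable vertex. If that vertex lies on a
      -- matching edge, this edge is cleared and the hole moves to it with one level less; at an
      -- outside vertex the hole is gone. Each step lists at most 24 items: 3 for the target, 18 for
      -- the colour, 3 for the new edge. The target is secured before the colour is acquired, as
      -- acquiring preserves only uncovered vertices listed in F.
      settle : (t : Freeable ℓ u) (σ : State (slots t ++ H)) → Ready t σ → ℓ * 24 + length (F σ) ≤ B →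
               Settled {slots t} {H} σ t
      settle (outside _) σ ready b = record
        { τ = σ ; grow = λ q → q ; keep = λ _ _ h → h ; size = m≤n+m _ _ }
      settle {H = H} (via {ℓ} ν exits) σ (roots , res⊆) b = record
        { τ = Settled.τ rest
        ; grow = λ q → Settled.grow rest (growᵨ q)
        ; keep = λ v∈ ¬root h → Settled.keep rest (growᵨ v∈) (λ r → root∉F σ target tgt∉F r v∈)
                   (keepᵨ (λ q → ¬root (trans (sym src≡) q)) (∉∈⇒≢ tgt∉F v∈)
                     (Acquired.keep acq (Secured.grow sec v∈) (Secured.keep sec h)))
        ; size = ≤-trans (Settled.size rest) (≤-trans (+-monoʳ-≤ (ℓ * 24) sizeᵨ) (≤-reflexive shuffle))
        }
        where
        x = srcᴹ ν
        len = length (F σ)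
        x∈F : inj₁ x ∈ F σ
        x∈F = res⊆ (end∈items (f (proj₁ ν)) (proj₂ ν))
        open Exit (exits (F σ) (≤-trans (m≤n+m len _) b))

        -- The only matching dart leaving x is ν itself, and its target lies in F, which the target
        -- of d avoids.
        new : ∀ μ → d ≢ edgeᴹ μ
        new μ e = tgt∉F (subst (λ y → inj₁ y ∈ F σ) (sym (trans (cong tgt e) (cong tgtᴹ μ≡ν)))
                           (res⊆ (end∈items (f (proj₁ ν)) (not (proj₂ ν)))))
          where
          μ≡ν : μ ≡ ν
          μ≡ν = srcᴹ-injective (trans (cong src (sym e)) src≡)

        sec = secure σ target tgt∉F
        σ₁ = Secured.τ sec

        col∉F₁ : inj₂ (colour d) ∉ F σ₁
        col∉F₁ q = colour∉reserved d new target refl col∉F (Secured.shrink sec q)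

        acq : Acquired σ₁ (colour d)
        acq = acquire σ₁ (≤-trans (+-monoʳ-≤ 3 (Secured.size sec))
                           (≤-trans (+-monoˡ-≤ len {6} {24 + ℓ * 24} (m≤m+n 6 _)) b)) free col∉F₁
        σ₂ = Acquired.τ acq

        rep : Replaceable σ₂ (suc (proj₁ ν))
        rep t refl = touched σ₂ ν (Acquired.grow acq (Secured.grow sec x∈F))

        unc : ∀ o → Uncovered σ₂ (src (proj₁ d , o))
        unc = both-ends (Uncovered σ₂) d
                (subst (Uncovered σ₂) (sym src≡)
                  (Acquired.keep acq (Secured.grow sec x∈F) (Secured.keep sec (roots x refl))))
                (Acquired.keep acq (Secured.reserved⊆ sec (reserved-self target)) (Secured.self sec))

        ρ : State (slots target ++ H)
        ρ = place σ₂ (suc (proj₁ ν)) rep (drop-middle (slots target)) (proj₁ d) unc (Acquired.unused acq)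

        keepᵨ : ∀ {v} → src d ≢ v → tgt d ≢ v → Uncovered σ₂ v → Uncovered ρ v
        keepᵨ {v} p q = place-uncovered σ₂ (suc (proj₁ ν)) rep (drop-middle (slots target)) (proj₁ d) unc
                      (Acquired.unused acq) (both-ends (_≢ v) d p q)

        growᵨ : ∀ {x} → x ∈ F σ → x ∈ F ρ
        growᵨ q = ∈-++⁺ʳ (items (proj₁ d)) (Acquired.grow acq (Secured.grow sec q))

        sizeᵨ : length (F ρ) ≤ 24 + len
        sizeᵨ = +-monoʳ-≤ 3 (≤-trans (Acquired.size acq) (+-monoʳ-≤ 18 (Secured.size sec)))

        shuffle : ℓ * 24 + (24 + len) ≡ 24 + ℓ * 24 + len
        shuffle = trans (sym (+-assoc (ℓ * 24) 24 len)) (cong (_+ len) (+-comm (ℓ * 24) 24))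

        readyᵨ : Ready target ρ
        readyᵨ = (λ v r → keepᵨ (λ q → root∉F σ target tgt∉F r
                                       (subst (λ y → inj₁ y ∈ F σ) (trans (sym src≡) q) x∈F))
                                (root≢self target r)
                                (Acquired.keep acq (Secured.reserved⊆ sec (reserved-root target r))
                                  (Secured.roots sec v r)))
               , λ q → ∈-++⁺ʳ (items (proj₁ d)) (Acquired.grow acq (Secured.reserved⊆ sec q))

        rest : Settled {slots target} {H} ρ target
        rest = settle target ρ readyᵨ
                 (≤-trans (+-monoʳ-≤ (ℓ * 24) sizeᵨ) (≤-trans (≤-reflexive shuffle) b))

      extract : State [] → HasRainbowMatching G col (suc s)
      extract σ = (λ a → proj₁ (slot a))
                , (λ a b a≢b → disjoint⇒¬share (proj₁ (compat σ a≢b (proj₂ (slot a)) (proj₂ (slot b)))))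
                , injective
        where
        slot : ∀ a → ∃ λ e → S σ a ≡ just e
        slot a with S σ a in eq
        ... | just e = e , refl
        ... | nothing with () ← holes σ a eq
        injective : Injective _≡_ _≡_ (λ a → col (proj₁ (slot a)))
        injective {a} {b} c with a ≟ b
        ... | yes p = p
        ... | no a≢b = ⊥-elim (proj₂ (compat σ a≢b (proj₂ (slot a)) (proj₂ (slot b))) c)

      initial : State (zero ∷ [])
      initial = record
        { S = λ { zero → nothing ; (suc t) → just (f t) } ; F = []
        ; compat = λ { {zero} {_} _ () ; {suc _} {zero} _ _ ()
                     ; {suc i} {suc j} i≢j refl refl → disj (i≢j ∘ cong suc) , (i≢j ∘ cong suc ∘ rain) }
        ; status = λ t → inj₁ (refl , (λ _ ()) , λ ())
        ; top = λ _ ()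
        ; holes = λ { zero _ → here refl ; (suc _) () } }

      -- The dart d fills the empty slot `zero`, and settling both ends refills every other slot.
      -- The budget is 3 + 3 for securing the ends, 18 for the colour and 3 for the new edge, then
      -- 24 per level at each end.
      augment : ∀ d → (∀ μ → d ≢ edgeᴹ μ) → FreeColour (colour d) →
                Freeable ℓ (src d) → Freeable ℓ (tgt d) → 27 + (ℓ * 24 + ℓ * 24) ≤ B →
                HasRainbowMatching G col (suc s)
      augment {ℓ} d new free tᵤ tᵥ b = extract (Settled.τ done)
        where
        secᵤ = secure initial tᵤ (λ ())
        σ₁ = Secured.τ secᵤ

        -- If securing the source of d had listed its target, both would be ends of one matching
        -- edge, and d would be that edge by simplicity. An outside source lists only itself.
        v∉reserved : (t : Freeable ℓ u) → u ≡ src d → inj₁ (tgt d) ∉ reserved t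
        v∉reserved (outside _) refl (here q) = src≢tgt d (sym (Sum.inj₁-injective q))
        v∉reserved (via (j , o) _) e q = ∉-items-vertex {f j} {tgt d} {[]} misses (λ ()) (∈-++⁺ˡ q)
          where
          misses : ∀ o′ → src (f j , o′) ≢ tgt d
          misses o′ p = new (j , not o′) (dart-unique-ends {d} {f j , not o′} other (sym (trans (cong (λ y → src (f j , y)) (Bool.not-involutive o′)) p)))
            where
            other : src d ≡ src (f j , not o′)
            other with o Bool.≟ o′
            ... | yes refl = sym e
            ... | no o≢o′ = ⊥-elim (src≢tgt d (trans (sym e) (trans (cong (λ y → src (f j , y)) (sym (Bool.¬-not (λ z → o≢o′ (sym z))))) p)))

        v∉F₁ : inj₁ (tgt d) ∉ F σ₁
        v∉F₁ q with ∈-++⁻ (reserved tᵤ) (Secured.shrink secᵤ q)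
        ... | inj₁ r = v∉reserved tᵤ refl r

        secᵥ = secure σ₁ tᵥ v∉F₁
        σ₂ = Secured.τ secᵥ

        new′ : ∀ μ → rev d ≢ edgeᴹ μ
        new′ μ q = new (flip μ) (trans (sym (rev-involutive d)) (cong rev q))

        col∉F₁ : inj₂ (colour d) ∉ F σ₁
        col∉F₁ q = colour∉reserved (rev d) new′ tᵤ (cong src (sym (rev-involutive d))) (λ ()) (Secured.shrink secᵤ q)

        col∉F₂ : inj₂ (colour d) ∉ F σ₂
        col∉F₂ q = colour∉reserved d new tᵥ refl col∉F₁ (Secured.shrink secᵥ q)

        size₂ : length (F σ₂) ≤ 6
        size₂ = ≤-trans (Secured.size secᵥ) (+-monoʳ-≤ 3 (Secured.size secᵤ))

        acq : Acquired σ₂ (colour d)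
        acq = acquire σ₂ (≤-trans (+-monoʳ-≤ 3 size₂) (≤-trans (m≤m+n 9 _) b)) free col∉F₂
        σ₃ = Acquired.τ acq

        rep : Replaceable σ₃ zero
        rep t ()

        in₂ : ∀ {x} → x ∈ F σ₁ → x ∈ F σ₂
        in₂ = Secured.grow secᵥ

        unc : ∀ o → Uncovered σ₃ (src (proj₁ d , o))
        unc = both-ends (Uncovered σ₃) d
                (Acquired.keep acq (in₂ (Secured.reserved⊆ secᵤ (reserved-self tᵤ)))
                  (Secured.keep secᵥ (Secured.self secᵤ)))
                (Acquired.keep acq (Secured.reserved⊆ secᵥ (reserved-self tᵥ)) (Secured.self secᵥ))

        hs : ∀ {b} → b ∈ slots tᵥ ++ slots tᵤ ++ zero ∷ [] → b ≡ zero ⊎ b ∈ slots tᵥ ++ slots tᵤ ++ []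
        hs q with ∈-++⁻ (slots tᵥ) q
        ... | inj₁ r = inj₂ (∈-++⁺ˡ r)
        ... | inj₂ r with drop-middle (slots tᵤ) r
        ...   | inj₁ e = inj₁ e
        ...   | inj₂ r′ = inj₂ (∈-++⁺ʳ (slots tᵥ) r′)

        ρ : State (slots tᵥ ++ slots tᵤ ++ [])
        ρ = place σ₃ zero rep hs (proj₁ d) unc (Acquired.unused acq)

        keepᵨ : ∀ {v} → src d ≢ v → tgt d ≢ v → Uncovered σ₃ v → Uncovered ρ v
        keepᵨ {v} p q = place-uncovered σ₃ zero rep hs (proj₁ d) unc (Acquired.unused acq) (both-ends (_≢ v) d p q)

        in₃ : ∀ {x} → x ∈ F σ₂ → x ∈ F ρ
        in₃ q = ∈-++⁺ʳ (items (proj₁ d)) (Acquired.grow acq q)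

        sizeᵨ : length (F ρ) ≤ 27
        sizeᵨ = +-monoʳ-≤ 3 (≤-trans (Acquired.size acq) (+-monoʳ-≤ 18 size₂))

        readyᵥ : Ready tᵥ ρ
        readyᵥ = (λ v r → keepᵨ (λ q → root∉F σ₁ tᵥ v∉F₁ r
                                   (subst (λ y → inj₁ y ∈ F σ₁) q (Secured.reserved⊆ secᵤ (reserved-self tᵤ))))
                                (root≢self tᵥ r)
                                (Acquired.keep acq (Secured.reserved⊆ secᵥ (reserved-root tᵥ r)) (Secured.roots secᵥ v r)))
               , λ q → in₃ (Secured.reserved⊆ secᵥ q)

        doneᵥ : Settled {slots tᵥ} {slots tᵤ ++ []} ρ tᵥ
        doneᵥ = settle tᵥ ρ readyᵥ (≤-trans (+-monoʳ-≤ (ℓ * 24) sizeᵨ)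
                  (≤-trans (≤-reflexive (+-comm (ℓ * 24) 27)) (≤-trans (+-monoʳ-≤ 27 (m≤m+n (ℓ * 24) _)) b)))

        root∈F₁ : ∀ {v} → Root tᵤ v → inj₁ v ∈ F σ₁
        root∈F₁ r = Secured.reserved⊆ secᵤ (reserved-root tᵤ r)

        -- The root on the side of u survives the settling of v: it is listed in F and differs from
        -- the root on the side of v.
        readyᵤ : Ready tᵤ (Settled.τ doneᵥ)
        readyᵤ = (λ v r → Settled.keep doneᵥ (in₃ (in₂ (root∈F₁ r)))
                            (λ r′ → root∉F σ₁ tᵥ v∉F₁ r′ (root∈F₁ r))
                            (keepᵨ (root≢self tᵤ r) (∉∈⇒≢ v∉F₁ (root∈F₁ r))
                              (Acquired.keep acq (in₂ (root∈F₁ r)) (Secured.keep secᵥ (Secured.roots secᵤ v r)))))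
               , λ q → Settled.grow doneᵥ (in₃ (in₂ (Secured.reserved⊆ secᵤ q)))

        done : Settled {slots tᵤ} {[]} (Settled.τ doneᵥ) tᵤ
        done = settle tᵤ (Settled.τ doneᵥ) readyᵤ
                 (≤-trans (+-monoʳ-≤ (ℓ * 24) (≤-trans (Settled.size doneᵥ) (+-monoʳ-≤ (ℓ * 24) sizeᵨ)))
                   (≤-trans (≤-reflexive (trans (sym (+-assoc (ℓ * 24) (ℓ * 24) 27)) (+-comm _ 27))) b))

  -- Counting darts: degrees and colour classes

  bools : List Bool
  bools = true ∷ false ∷ []

  ∈-bools : ∀ b → b ∈ bools
  ∈-bools true  = here refl
  ∈-bools false = there (here refl)

  bools-unique : Unique bools
  bools-unique = ((λ ()) ∷ []) ∷ ([] ∷ [])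

  ∑-product : {X Y : Set} (xs : List X) (ys : List Y) (f : X × Y → ℕ) →
              ∑ (cartesianProduct xs ys) f ≡ ∑ xs (λ x → ∑ ys (λ y → f (x , y)))
  ∑-product []       ys f = refl
  ∑-product (x ∷ xs) ys f =
    trans (∑-++ (map (x ,_) ys) _ f) (cong₂ _+_ (∑-map (x ,_) ys f) (∑-product xs ys f))

  ∑-oriented-not : {X : Set} (xs : List X) (f : X × Bool → ℕ) →
                   ∑ (cartesianProduct xs bools) (λ (x , o) → f (x , not o)) ≡ ∑ (cartesianProduct xs bools) f
  ∑-oriented-not xs f = begin
    ∑ (cartesianProduct xs bools) (λ (x , o) → f (x , not o))  ≡⟨ ∑-product xs bools _ ⟩
    ∑ xs (λ x → f (x , false) + (f (x , true) + 0))             ≡⟨ ∑-cong xs (λ x → swap (f (x , false)) (f (x , true))) ⟩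
    ∑ xs (λ x → f (x , true) + (f (x , false) + 0))             ≡⟨ ∑-product xs bools f ⟨
    ∑ (cartesianProduct xs bools) f                             ∎
    where
    open ≡-Reasoning
    swap : ∀ a b → a + (b + 0) ≡ b + (a + 0)
    swap a b = trans (cong (a +_) (+-identityʳ b)) (trans (+-comm a b) (cong (b +_) (sym (+-identityʳ a))))

  module Degrees {n m k : ℕ} (G : SimpleGraph n m) (col : Fin m → Fin k)
                 (proper : IsProperColouring G col) where
    open Darts G col proper

    open Dec∈ {A = Item} (Sum.≡-dec _≟_ _≟_) using (_∈?_)

    darts : List Dart
    darts = cartesianProduct (allFin m) bools

    ∈-darts : ∀ d → d ∈ darts
    ∈-darts (z , o) = ∈-cartesianProduct⁺ (∈-allFin z) (∈-bools o)

    darts-unique : Unique darts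
    darts-unique = Unique.cartesianProduct⁺ (Unique.allFin⁺ m) bools-unique

    deg : {P : Dart → Set} → Fin n → (∀ d → Dec (P d)) → ℕ
    deg x P? = ∑ darts (λ d → ⟦ (src d ≟ x) ×-dec P? d ⟧)

    Avoids : List Item → Dart → Set
    Avoids F d = inj₁ (tgt d) ∉ F × inj₂ (colour d) ∉ F

    Hits : Item → Dart → Set
    Hits (inj₁ v) d = v ≡ tgt d
    Hits (inj₂ c) d = c ≡ colour d

    hits? : ∀ φ d → Dec (Hits φ d)
    hits? (inj₁ v) d = v ≟ tgt d
    hits? (inj₂ c) d = c ≟ colour d

    avoids? : ∀ F d → Dec (Avoids F d)
    avoids? F d = ¬? (inj₁ (tgt d) ∈? F) ×-dec ¬? (inj₂ (colour d) ∈? F)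

    ¬avoids : ∀ F d → ¬ Avoids F d → ∃ λ φ → φ ∈ F × Hits φ d
    ¬avoids F d h with inj₁ (tgt d) ∈? F | inj₂ (colour d) ∈? F
    ... | yes p | _     = _ , p , refl
    ... | no _  | yes q = _ , q , refl
    ... | no p  | no q  = ⊥-elim (h (p , q))

    hits-unique : ∀ φ {d d′} → src d ≡ src d′ → Hits φ d → Hits φ d′ → d ≡ d′
    hits-unique (inj₁ v) p q r = dart-unique-ends p (trans (sym q) r)
    hits-unique (inj₂ c) p q r = dart-unique-colour p (trans (sym q) r)

    module _ {P : Dart → Set} (x : Fin n) (P? : ∀ d → Dec (P d)) where
      private
        opt? : ∀ d → Dec (src d ≡ x × P d)
        opt? d = (src d ≟ x) ×-dec P? d

      -- Every item excludes at most one of the darts leaving x.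
      deg-≤-avoiding : ∀ F → deg x P? ≤ length F + ∑ darts (λ d → ⟦ opt? d ×-dec avoids? F d ⟧)
      deg-≤-avoiding F = begin
        deg x P?                                                     ≤⟨ ∑-mono darts split ⟩
        ∑ darts (λ d → ∑ F (λ φ → hit φ d) + rest d)                 ≡⟨ ∑-+ darts _ rest ⟩
        ∑ darts (λ d → ∑ F (λ φ → hit φ d)) + ∑ darts rest           ≡⟨ cong (_+ ∑ darts rest) (∑-swap darts F (λ d φ → hit φ d)) ⟩
        ∑ F (λ φ → ∑ darts (hit φ)) + ∑ darts rest                   ≤⟨ +-monoˡ-≤ _ (∑-≤-length F (λ φ _ → one φ)) ⟩
        length F + ∑ darts rest                                      ∎
        where
        open ≤-Reasoning
        hit : Item → Dart → ℕ
        hit φ d = ⟦ opt? d ×-dec hits? φ d ⟧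
        rest : Dart → ℕ
        rest d = ⟦ opt? d ×-dec avoids? F d ⟧
        split : ∀ d → ⟦ opt? d ⟧ ≤ ∑ F (λ φ → hit φ d) + rest d
        split d = ⟦⟧-bound (opt? d) λ o → by-cases o (avoids? F d)
          where
          by-cases : src d ≡ x × P d → Dec (Avoids F d) → 1 ≤ ∑ F (λ φ → hit φ d) + rest d
          by-cases o (yes a) = ≤-trans (≤-reflexive (sym (⟦⟧-true (opt? d ×-dec avoids? F d) (o , a)))) (m≤n+m _ _)
          by-cases o (no ¬a) with φ , φ∈ , h ← ¬avoids F d ¬a =
            ≤-trans (≤-reflexive (sym (⟦⟧-true (opt? d ×-dec hits? φ d) (o , h))))
              (≤-trans (∑-term F (λ φ → hit φ d) φ∈) (m≤m+n _ _))
        one : ∀ φ → ∑ darts (hit φ) ≤ 1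
        one φ = ∑-atMostOne darts-unique (λ d → ⟦⟧≤1 (opt? d ×-dec hits? φ d)) λ {d} {d′} _ _ p q →
          let ((e , _) , h) = ⟦⟧-positive (opt? d ×-dec hits? φ d) p
              ((e′ , _) , h′) = ⟦⟧-positive (opt? d′ ×-dec hits? φ d′) q
          in hits-unique φ (trans e (sym e′)) h h′

      pick : ∀ F → length F < deg x P? → ∃ λ d → src d ≡ x × P d × Avoids F d
      pick F lt with d , _ , pos ← ∑-<⇒∃ darts (λ d → ⟦ opt? d ×-dec avoids? F d ⟧) (λ _ → 0)
                       (≤-<-trans (≤-reflexive (∑-0 darts)) (+-cancelˡ-< (length F) 0 _
                         (≤-<-trans (≤-reflexive (+-identityʳ (length F))) (<-≤-trans lt (deg-≤-avoiding F)))))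
        with (e , h) , a ← ⟦⟧-positive (opt? d ×-dec avoids? F d) pos = d , e , h , a

    ∑-cover : {X : Set} (xs : List X) (v : X → Fin n) {Q : Dart → Set} (Q? : ∀ d → Dec (Q d)) →
              ∑ darts (λ d → ⟦ any? (λ x → v x ≟ src d) xs ×-dec Q? d ⟧) ≤ ∑ xs (λ x → deg (v x) Q?)
    ∑-cover xs v {Q} Q? = begin
      ∑ darts (λ d → ⟦ any? (λ x → v x ≟ src d) xs ×-dec Q? d ⟧)        ≤⟨ ∑-mono darts (λ d → ⟦⟧-bound (any? (λ x → v x ≟ src d) xs ×-dec Q? d) (found d)) ⟩
      ∑ darts (λ d → ∑ xs (λ x → ⟦ (src d ≟ v x) ×-dec Q? d ⟧))          ≡⟨ ∑-swap darts xs _ ⟩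
      ∑ xs (λ x → deg (v x) Q?)                                          ∎
      where
      open ≤-Reasoning
      found : ∀ d → Any (λ x → v x ≡ src d) xs × Q d → 1 ≤ ∑ xs (λ x → ⟦ (src d ≟ v x) ×-dec Q? d ⟧)
      found d (a , h) with x , x∈ , e ← find a =
        ≤-trans (≤-reflexive (sym (⟦⟧-true ((src d ≟ v x) ×-dec Q? d) (sym e , h))))
                (∑-term xs (λ x → ⟦ (src d ≟ v x) ×-dec Q? d ⟧) x∈)

    module _ {q : ℕ} (often : ∀ c → AppearsAtLeast col q c) where
      class-size : ∀ c → q ≤ ∑ (allFin m) (λ z → ⟦ col z ≟ c ⟧)
      class-size c = begin
        q                                                         ≡⟨ length-tabulate {n = q} (λ t → t) ⟨
        length (allFin q)                                         ≡⟨ *-identityʳ _ ⟨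
        length (allFin q) * 1                                     ≡⟨ ∑-const (allFin q) 1 ⟨
        ∑ (allFin q) (λ _ → 1)                                    ≤⟨ ∑-mono (allFin q) (λ t → ≤-trans (≤-reflexive (sym (⟦⟧-true (g t ≟ g t) refl)))
                                                                        (∑-term (allFin m) (λ z → ⟦ g t ≟ z ⟧) (∈-allFin (g t)))) ⟩
        ∑ (allFin q) (λ t → ∑ (allFin m) (λ z → ⟦ g t ≟ z ⟧))      ≡⟨ ∑-swap (allFin q) (allFin m) _ ⟩
        ∑ (allFin m) (λ z → ∑ (allFin q) (λ t → ⟦ g t ≟ z ⟧))      ≤⟨ ∑-mono (allFin m) fibre ⟩
        ∑ (allFin m) (λ z → ⟦ col z ≟ c ⟧)                        ∎
        where
        open ≤-Reasoning
        g = proj₁ (often c)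
        fibre : ∀ z → ∑ (allFin q) (λ t → ⟦ g t ≟ z ⟧) ≤ ⟦ col z ≟ c ⟧
        fibre z with col z ≟ c
        ... | yes _ = ∑-atMostOne (Unique.allFin⁺ q) (λ t → ⟦⟧≤1 (g t ≟ z)) λ {t} {t′} _ _ p r →
                proj₁ (proj₂ (often c)) (trans (⟦⟧-positive (g t ≟ z) p) (sym (⟦⟧-positive (g t′ ≟ z) r)))
        ... | no ¬e = ≤-trans (∑-≤-const (allFin q) 0 λ t _ → ⟦⟧-bound (g t ≟ z)
                        λ e → ⊥-elim (¬e (trans (sym (cong col e)) (proj₂ (proj₂ (often c)) t))))
                        (≤-reflexive (*-zeroʳ (length (allFin q))))

    module _ {D : Fin k → Set} (D? : ∀ c → Dec (D c)) where
      palette : List (Fin k)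
      palette = filter D? (allFin k)

      -- By properness each colour labels at most one dart leaving x; so more darts than colours
      -- would leave one that avoids the whole palette.
      deg-≤-palette : ∀ x → deg x (D? ∘ colour) ≤ length palette
      deg-≤-palette x = ≮⇒≥ λ lt →
        let (d , _ , Dd , _ , c∉) = pick x (D? ∘ colour) (map inj₂ palette) (≤-<-trans (≤-reflexive (length-map inj₂ palette)) lt)
        in c∉ (∈-map⁺ inj₂ (∈-filter⁺ D? (∈-allFin (colour d)) Dd))

      darts-of-palette : ∀ {q} → (∀ c → AppearsAtLeast col q c) →
                         length palette * (q + q) ≤ ∑ darts (λ d → ⟦ D? (colour d) ⟧)
      darts-of-palette {q} often = begin
        length palette * (q + q)                                           ≡⟨ ∑-const palette (q + q) ⟨
        ∑ palette (λ _ → q + q)                                            ≤⟨ ∑-mono palette (λ c → twice c) ⟩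
        ∑ palette (λ c → ∑ darts (λ d → ⟦ colour d ≟ c ⟧))                  ≡⟨ ∑-swap palette darts _ ⟩
        ∑ darts (λ d → ∑ palette (λ c → ⟦ colour d ≟ c ⟧))                  ≤⟨ ∑-mono darts once ⟩
        ∑ darts (λ d → ⟦ D? (colour d) ⟧)                                   ∎
        where
        open ≤-Reasoning
        twice : ∀ c → q + q ≤ ∑ darts (λ d → ⟦ colour d ≟ c ⟧)
        twice c = begin
          q + q                                                            ≤⟨ +-mono-≤ (class-size often c) (class-size often c) ⟩
          ∑ (allFin m) φ + ∑ (allFin m) φ                                  ≡⟨ ∑-+ (allFin m) φ φ ⟨
          ∑ (allFin m) (λ z → φ z + φ z)                                   ≡⟨ ∑-cong (allFin m) (λ z → cong (φ z +_) (sym (+-identityʳ (φ z)))) ⟩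
          ∑ (allFin m) (λ z → φ z + (φ z + 0))                             ≡⟨ ∑-product (allFin m) bools _ ⟨
          ∑ darts (λ d → ⟦ colour d ≟ c ⟧)                                 ∎
          where
          φ : Fin m → ℕ
          φ z = ⟦ col z ≟ c ⟧
        once : ∀ d → ∑ palette (λ c → ⟦ colour d ≟ c ⟧) ≤ ⟦ D? (colour d) ⟧
        once d with D? (colour d)
        ... | yes _ = ∑-atMostOne (Unique.filter⁺ D? (Unique.allFin⁺ k)) (λ c → ⟦⟧≤1 (colour d ≟ c)) λ {c} {c′} _ _ p r →
                trans (sym (⟦⟧-positive (colour d ≟ c) p)) (⟦⟧-positive (colour d ≟ c′) r)
        ... | no ¬D = ≤-trans (∑-≤-const palette 0 λ c c∈ → ⟦⟧-bound (colour d ≟ c)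
                        λ e → ⊥-elim (¬D (subst D (sym e) (proj₂ (∈-filter⁻ D? {xs = allFin k} c∈)))))
                        (≤-reflexive (*-zeroʳ (length palette)))

  -- Chains of links and their extension

  module Stages {n m k : ℕ} (G : SimpleGraph n m) (col : Fin m → Fin k) (proper : IsProperColouring G col)
    {s : ℕ} (f : Fin s → Fin m)
    (disj : ∀ {i j} → i ≢ j → Darts.Disjoint G col proper (f i) (f j))
    (rain : Injective _≡_ _≡_ (λ i → col (f i))) (B w : ℕ) where
    open Darts G col proper
    open Degrees G col proper
    open Augmentation f disj rain B

    -- A link with j predecessors is freeable at every level ℓ with j < ℓ * w, so its level is
    -- governed by j/w rather than by j.
    data Chain : List MDart → Set where
      []   : Chain []
      link : ∀ {μ L} → proj₁ μ ∉ map proj₁ L → (∀ ℓ → length L < ℓ * w → Freeable ℓ (tgtᴹ μ)) →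
             Chain L → Chain (μ ∷ L)

    chain-unique : ∀ {L} → Chain L → Unique (map proj₁ L)
    chain-unique []             = []
    chain-unique {μ ∷ L} (link μ∉ _ c) = All.tabulate (λ i∈ e → μ∉ (subst (_∈ map proj₁ L) (sym e) i∈)) ∷ chain-unique c

    chain-freeable : ∀ {L} → Chain L → ∀ {ν ℓ} → ν ∈ L → length L ≤ ℓ * w → Freeable ℓ (tgtᴹ ν)
    chain-freeable (link _ h _) (here refl) b = h _ b
    chain-freeable (link _ _ c) (there p)   b = chain-freeable c p (≤-trans (n≤1+n _) b)

    chain-drop : ∀ j {L} → Chain L → Chain (drop j L)
    chain-drop zero    c            = c
    chain-drop (suc j) []           = []
    chain-drop (suc j) (link _ _ c) = chain-drop j c

    mdarts : List MDart
    mdarts = cartesianProduct (allFin s) bools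

    ∈-mdarts : ∀ μ → μ ∈ mdarts
    ∈-mdarts (i , o) = ∈-cartesianProduct⁺ (∈-allFin i) (∈-bools o)

    flip-involutive : ∀ μ → flip (flip μ) ≡ μ
    flip-involutive (i , true)  = refl
    flip-involutive (i , false) = refl

    module Stage (L : List MDart) (chain : Chain L) where
      open Dec∈ {A = Fin s} _≟_ using (_∈?_)

      idx : List (Fin s)
      idx = map proj₁ L

      remaining : List (Fin s)
      remaining = filter (λ i → ¬? (i ∈? idx)) (allFin s)

      Cs : List MDart
      Cs = cartesianProduct remaining bools

      remaining⁺ : ∀ {i} → i ∉ idx → i ∈ remaining
      remaining⁺ = ∈-filter⁺ (λ i → ¬? (i ∈? idx)) (∈-allFin _)

      remaining⁻ : ∀ {i} → i ∈ remaining → i ∉ idx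
      remaining⁻ i∈ = proj₂ (∈-filter⁻ (λ i → ¬? (i ∈? idx)) {xs = allFin s} i∈)

      Cs⁺ : ∀ {μ} → proj₁ μ ∉ idx → μ ∈ Cs
      Cs⁺ {i , o} i∉ = ∈-cartesianProduct⁺ (remaining⁺ i∉) (∈-bools o)

      Cs⁻ : ∀ {μ} → μ ∈ Cs → proj₁ μ ∉ idx
      Cs⁻ μ∈ = remaining⁻ (proj₁ (∈-cartesianProduct⁻ remaining bools μ∈))

      Cs-flip : ∀ {μ} → μ ∈ Cs → flip μ ∈ Cs
      Cs-flip μ∈ = Cs⁺ (Cs⁻ μ∈)

      Cs-unique : Unique Cs
      Cs-unique = Unique.cartesianProduct⁺ (Unique.filter⁺ (λ i → ¬? (i ∈? idx)) (Unique.allFin⁺ s)) bools-unique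

      length-Cs : length Cs ≡ length remaining + length remaining
      length-Cs = begin
        length Cs                                     ≡⟨ *-identityʳ _ ⟨
        length Cs * 1                                 ≡⟨ ∑-const Cs 1 ⟨
        ∑ Cs (λ _ → 1)                                ≡⟨ ∑-product remaining bools _ ⟩
        ∑ remaining (λ _ → 2)                         ≡⟨ ∑-const remaining 2 ⟩
        length remaining * 2                          ≡⟨ *-comm (length remaining) 2 ⟩
        length remaining + (length remaining + 0)     ≡⟨ cong (length remaining +_) (+-identityʳ _) ⟩
        length remaining + length remaining           ∎
        where open ≡-Reasoning

      remaining+chain : length remaining + length L ≤ s
      remaining+chain = begin
        length remaining + length L                                                     ≡⟨ cong₂ _+_ (length-filter-∑ (λ i → ¬? (i ∈? idx)) (allFin s)) (sym (trans (∑-const idx 1) (trans (*-identityʳ _) (length-map proj₁ L)))) ⟩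
        ∑ (allFin s) (λ i → ⟦ ¬? (i ∈? idx) ⟧) + ∑ idx (λ _ → 1)                         ≤⟨ +-monoʳ-≤ _ (∑-mono idx λ j → ≤-trans (≤-reflexive (sym (⟦⟧-true (j ≟ j) refl))) (∑-term (allFin s) (λ i → ⟦ j ≟ i ⟧) (∈-allFin j))) ⟩
        ∑ (allFin s) (λ i → ⟦ ¬? (i ∈? idx) ⟧) + ∑ idx (λ j → ∑ (allFin s) (λ i → ⟦ j ≟ i ⟧)) ≡⟨ cong (∑ (allFin s) (λ i → ⟦ ¬? (i ∈? idx) ⟧) +_) (∑-swap idx (allFin s) _) ⟩
        ∑ (allFin s) (λ i → ⟦ ¬? (i ∈? idx) ⟧) + ∑ (allFin s) (λ i → ∑ idx (λ j → ⟦ j ≟ i ⟧)) ≡⟨ ∑-+ (allFin s) _ _ ⟨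
        ∑ (allFin s) (λ i → ⟦ ¬? (i ∈? idx) ⟧ + ∑ idx (λ j → ⟦ j ≟ i ⟧))                  ≤⟨ ∑-≤-length (allFin s) (λ i _ → once i) ⟩
        length (allFin s)                                                                ≡⟨ length-tabulate (λ i → i) ⟩
        s                                                                                ∎
        where
        open ≤-Reasoning
        once : ∀ i → ⟦ ¬? (i ∈? idx) ⟧ + ∑ idx (λ j → ⟦ j ≟ i ⟧) ≤ 1
        once i with i ∈? idx
        ... | yes _ = ∑-atMostOne (chain-unique chain) (λ j → ⟦⟧≤1 (j ≟ i)) λ {j} {j′} _ _ p q →
                trans (⟦⟧-positive (j ≟ i) p) (sym (⟦⟧-positive (j′ ≟ i) q))
        ... | no i∉ = +-monoʳ-≤ 1 (≤-trans (∑-≤-const idx 0 λ j j∈ → ⟦⟧-bound (j ≟ i) λ e → ⊥-elim (i∉ (subst (_∈ idx) e j∈)))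
                        (≤-reflexive (*-zeroʳ (length idx))))

      -- A consists of the ends x of the links and C of the ends of the remaining matching edges.
      -- The rest, R, is made of the outside vertices and the ends y of the links, all of them
      -- freeable.
      InA InC InR : Fin n → Set
      InA v = Any (λ ν → srcᴹ ν ≡ v) L
      InC v = Any (λ μ → srcᴹ μ ≡ v) Cs
      InR v = ¬ InA v × ¬ InC v

      inA? : ∀ v → Dec (InA v)
      inA? v = any? (λ ν → srcᴹ ν ≟ v) L
      inC? : ∀ v → Dec (InC v)
      inC? v = any? (λ μ → srcᴹ μ ≟ v) Cs
      inR? : ∀ v → Dec (InR v)
      inR? v = ¬? (inA? v) ×-dec ¬? (inC? v)

      inR-cases : ∀ {v} → InR v → Outside v ⊎ ∃ λ ν → ν ∈ L × tgtᴹ ν ≡ v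
      inR-cases {v} (¬A , ¬C) with any? (λ μ → srcᴹ μ ≟ v) mdarts
      ... | no ¬M = inj₁ λ μ e → ¬M (lose (∈-mdarts μ) e)
      ... | yes M with μ , _ , e ← find M with proj₁ μ ∈? idx
      ...   | no i∉ = ⊥-elim (¬C (lose (Cs⁺ {μ} i∉) e))
      ...   | yes i∈ with ν , ν∈ , eq ← ∈-map⁻ proj₁ i∈ = inj₂ (ν , ν∈ , trans (other μ ν e eq (λ z → ¬A (lose ν∈ z))) e)
        where
        other : ∀ μ ν → srcᴹ μ ≡ v → proj₁ μ ≡ proj₁ ν → srcᴹ ν ≢ v → tgtᴹ ν ≡ srcᴹ μ
        other (i , true)  (.i , true)  e refl h = ⊥-elim (h e)
        other (i , true)  (.i , false) e refl h = refl
        other (i , false) (.i , true)  e refl h = refl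
        other (i , false) (.i , false) e refl h = ⊥-elim (h e)

      inR-freeable : ∀ {ℓ v} → length L ≤ ℓ * w → InR v → Freeable ℓ v
      inR-freeable b r with inR-cases r
      ... | inj₁ out = outside out
      ... | inj₂ (ν , ν∈ , refl) = chain-freeable chain ν∈ b

      -- A link has one end in A, and a remaining edge lies within C. Hence a dart inside R is not a
      -- matching edge, as `augment` demands.
      edge-not-inR : ∀ μ → InR (srcᴹ μ) → InR (tgtᴹ μ) → ⊥
      edge-not-inR μ r r′ with proj₁ μ ∈? idx
      ... | no i∉ = proj₂ r (lose (Cs⁺ {μ} i∉) refl)
      ... | yes i∈ with ν , ν∈ , eq ← ∈-map⁻ proj₁ i∈ = split μ ν eq ν∈ r r′
        where
        split : ∀ μ ν → proj₁ μ ≡ proj₁ ν → ν ∈ L → InR (srcᴹ μ) → InR (tgtᴹ μ) → ⊥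
        split (i , true)  (.i , true)  refl ν∈ r r′ = proj₁ r (lose ν∈ refl)
        split (i , true)  (.i , false) refl ν∈ r r′ = proj₁ r′ (lose ν∈ refl)
        split (i , false) (.i , true)  refl ν∈ r r′ = proj₁ r′ (lose ν∈ refl)
        split (i , false) (.i , false) refl ν∈ r r′ = proj₁ r (lose ν∈ refl)

      module Palette {D : Fin k → Set} (D? : ∀ c → Dec (D c)) where
        toC? : ∀ d → Dec (D (colour d) × InC (tgt d))
        toC? d = D? (colour d) ×-dec inC? (tgt d)

        toR? : ∀ d → Dec (D (colour d) × InR (tgt d))
        toR? d = D? (colour d) ×-dec inR? (tgt d)

        degC degR : MDart → ℕ
        degC μ = deg (srcᴹ μ) toC?
        degR μ = deg (srcᴹ μ) toR?

        -- The last w targets are skipped, so that the level grows only once in w links.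
        extend : (∀ c → D c → FreeColour c) → B < w → ∀ {μ} → μ ∈ Cs → w + w ≤ degR μ → Chain (μ ∷ L)
        extend free B<w {μ} μ∈ big = link (Cs⁻ μ∈) freeable chain
          where
          freeable : ∀ ℓ → length L < ℓ * w → Freeable ℓ (tgtᴹ μ)
          freeable zero ()
          freeable (suc ℓ) b = via μ exit
            where
            recent : List Item
            recent = map (inj₁ ∘ tgtᴹ) (take w L)
            -- Of the 2w darts, at most w are lost to the recent targets and at most B, which is
            -- below w, to F.
            recent-size : ∀ F → length F ≤ B → length (recent ++ F) < w + w
            recent-size F F≤ = ≤-<-trans
              (≤-reflexive (trans (length-++ recent) (cong (_+ length F) (trans (length-map _ (take w L)) (length-take w L)))))
              (+-mono-≤-< (m⊓n≤m w (length L)) (≤-<-trans F≤ B<w))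
            target : ∀ F {v} → inj₁ v ∉ recent ++ F → Outside v ⊎ (∃ λ ν → ν ∈ L × tgtᴹ ν ≡ v) → Freeable ℓ v
            target F v∉ (inj₁ out) = outside out
            target F v∉ (inj₂ (ν , ν∈ , refl)) with ∈-++⁻ (take w L) (subst (ν ∈_) (sym (take++drop≡id w L)) ν∈)
            ... | inj₁ early = ⊥-elim (v∉ (∈-++⁺ˡ (∈-map⁺ (inj₁ ∘ tgtᴹ) early)))
            ... | inj₂ late  = chain-freeable (chain-drop w chain) late
                    (≤-trans (≤-reflexive (length-drop w L))
                       (≤-trans (∸-monoˡ-≤ w (<⇒≤ b)) (≤-reflexive (m+n∸m≡n w (ℓ * w)))))
            take-exit : ∀ F → (∃ λ d → src d ≡ srcᴹ μ × (D (colour d) × InR (tgt d)) × Avoids (recent ++ F) d) →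
                        Exit ℓ (srcᴹ μ) F
            take-exit F (d , e , (Dd , r) , v∉ , c∉) = record
              { d = d ; src≡ = e ; tgt∉F = v∉ ∘ ∈-++⁺ʳ recent ; col∉F = c∉ ∘ ∈-++⁺ʳ recent
              ; free = free _ Dd ; target = target F v∉ (inR-cases r) }
            exit : ∀ F → length F ≤ B → Exit ℓ (srcᴹ μ) F
            exit F F≤ = take-exit F (pick (srcᴹ μ) toR? (recent ++ F) (<-≤-trans (recent-size F F≤) big))

        NoInner : Set
        NoInner = ∀ d → D (colour d) → InR (src d) → ¬ InR (tgt d)

        progress : ∀ {ℓ} → (∀ c → D c → FreeColour c) → B < w → length L ≤ ℓ * w → 27 + (ℓ * 24 + ℓ * 24) ≤ B →
                   HasRainbowMatching G col (suc s) ⊎ (∃ λ μ → Chain (μ ∷ L)) ⊎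
                   (NoInner × ∀ μ → μ ∈ Cs → degR μ ≤ w + w)
        progress {ℓ} free B<w short enough
          with any? (λ d → D? (colour d) ×-dec (inR? (src d) ×-dec inR? (tgt d))) darts
        ... | yes a with d , _ , Dd , r , r′ ← find a =
              inj₁ (augment d (λ { μ refl → edge-not-inR μ r r′ }) (free _ Dd)
                     (inR-freeable {ℓ} short r) (inR-freeable short r′) enough)
        ... | no ¬a with any? (λ μ → w + w ≤? degR μ) Cs
        ...   | yes b with μ , μ∈ , big ← find b = inj₂ (inj₁ (μ , extend free B<w μ∈ big))
        ...   | no ¬b = inj₂ (inj₂ ( (λ d Dd r r′ → ¬a (lose (∈-darts d) (Dd , r , r′)))
                                   , λ μ μ∈ → <⇒≤ (≰⇒> λ big → ¬b (lose μ∈ big))))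

        size : ℕ
        size = length (palette D?)

        -- Sort the darts by the classes of their ends. A vertex of A meets each colour at most
        -- once, which bounds the darts with an end in A, in both directions, by 2 * length L *
        -- size. Darts within C are counted by `degC`, those between C and R by `degR` in both
        -- directions, and there are none within R.
        double-count : NoInner → ∀ {q} → (∀ c → AppearsAtLeast col q c) →
                       size * (q + q) ≤ (length L * size + length L * size) + (∑ Cs degC + (∑ Cs degR + ∑ Cs degR))
        double-count no-inner {q} often = begin
          size * (q + q)                                                                ≤⟨ darts-of-palette D? often ⟩
          ∑ darts (λ d → ⟦ D? (colour d) ⟧)                                             ≤⟨ ∑-mono darts pointwise ⟩
          ∑ darts (λ d → (α d + α (rev d)) + (γ d + (ρ d + ρ (rev d))))                 ≡⟨ ∑-+ darts _ _ ⟩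
          ∑ darts (λ d → α d + α (rev d)) + ∑ darts (λ d → γ d + (ρ d + ρ (rev d)))     ≡⟨ cong₂ _+_ (trans (∑-+ darts _ _) (cong (∑ darts α +_) (∑-oriented-not (allFin m) α)))
                                                                                                    (trans (∑-+ darts _ _) (cong (∑ darts γ +_) (trans (∑-+ darts _ _) (cong (∑ darts ρ +_) (∑-oriented-not (allFin m) ρ))))) ⟩
          (∑ darts α + ∑ darts α) + (∑ darts γ + (∑ darts ρ + ∑ darts ρ))               ≤⟨ +-mono-≤ (+-mono-≤ α-bound α-bound)
                                                                                            (+-mono-≤ (∑-cover Cs srcᴹ toC?) (+-mono-≤ ρ-bound ρ-bound)) ⟩
          (length L * size + length L * size) + (∑ Cs degC + (∑ Cs degR + ∑ Cs degR))   ∎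
          where
          open ≤-Reasoning
          α γ ρ : Dart → ℕ
          α d = ⟦ inA? (src d) ×-dec D? (colour d) ⟧
          γ d = ⟦ inC? (src d) ×-dec toC? d ⟧
          ρ d = ⟦ inC? (src d) ×-dec toR? d ⟧
          ρ-bound : ∑ darts ρ ≤ ∑ Cs degR
          ρ-bound = ∑-cover Cs srcᴹ toR?
          α-bound : ∑ darts α ≤ length L * size
          α-bound = ≤-trans (∑-cover L srcᴹ (D? ∘ colour)) (∑-≤-const L size λ ν _ → deg-≤-palette D? (srcᴹ ν))
          holds : {P : Set} (p : Dec P) → P → 1 ≤ ⟦ p ⟧
          holds p x = ≤-reflexive (sym (⟦⟧-true p x))
          pointwise : ∀ d → ⟦ D? (colour d) ⟧ ≤ (α d + α (rev d)) + (γ d + (ρ d + ρ (rev d)))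
          pointwise d = ⟦⟧-bound (D? (colour d)) λ Dd →
            by-cases Dd (inA? (src d)) (inA? (tgt d)) (inC? (src d)) (inC? (tgt d))
            where
            by-cases : D (colour d) → Dec (InA (src d)) → Dec (InA (tgt d)) → Dec (InC (src d)) → Dec (InC (tgt d)) →
                       1 ≤ (α d + α (rev d)) + (γ d + (ρ d + ρ (rev d)))
            by-cases Dd (yes a) _ _ _ = ≤-trans (holds (inA? (src d) ×-dec D? (colour d)) (a , Dd)) (≤-trans (m≤m+n (α d) _) (m≤m+n _ _))
            by-cases Dd (no _) (yes a) _ _ = ≤-trans (holds (inA? (tgt d) ×-dec D? (colour d)) (a , Dd)) (≤-trans (m≤n+m (α (rev d)) (α d)) (m≤m+n _ _))
            by-cases Dd (no _) (no _) (yes c) (yes c′) = ≤-trans (holds (inC? (src d) ×-dec toC? d) (c , Dd , c′)) (≤-trans (m≤m+n (γ d) _) (m≤n+m _ (α d + α (rev d))))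
            by-cases Dd (no _) (no ¬a) (yes c) (no ¬c) = ≤-trans (holds (inC? (src d) ×-dec toR? d) (c , Dd , ¬a , ¬c))
              (≤-trans (m≤m+n (ρ d) _) (≤-trans (m≤n+m _ (γ d)) (m≤n+m _ (α d + α (rev d)))))
            by-cases Dd (no ¬a) (no _) (no ¬c) (yes c) = ≤-trans (holds (inC? (tgt d) ×-dec toR? (rev d)) (c , Dd , subst InR (cong src (sym (rev-involutive d))) (¬a , ¬c)))
              (≤-trans (m≤n+m (ρ (rev d)) (ρ d)) (≤-trans (m≤n+m _ (γ d)) (m≤n+m _ (α d + α (rev d)))))
            by-cases Dd (no ¬a) (no ¬a′) (no ¬c) (no ¬c′) = ⊥-elim (no-inner d Dd (¬a , ¬c) (¬a′ , ¬c′))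

  -- The degree bounds give y + y′ ≥ cc + 2g. Subtracting y ≤ φ + N leaves y′ ≥ M + 2g - φ ≥ M + φ +
  -- 2, which exceeds M + β + φ.
  count-bound : ∀ {cc g φ N M β y y′} → M + N ≡ cc → y ≤ φ + N → cc + (g + g) ≤ y + y → cc + (g + g) ≤ y′ + y′ →
                β ≤ 1 → φ < g → M + (β + φ) < y′
  count-bound {g = g} {φ} {N} {M} {β} {y} {y′} refl y≤ 2y 2y′ β≤ φ<g = ≰⇒> λ y′≤ → 4≰2
    (+-cancelˡ-≤ (4 * φ) 4 2 (begin
      4 * φ + 4       ≡⟨ e₀ φ ⟩
      4 * suc φ       ≤⟨ *-monoʳ-≤ 4 φ<g ⟩
      4 * g           ≤⟨ +-cancelˡ-≤ ((M + N) + (M + N)) (4 * g) (4 * φ + 2) (begin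
        (M + N) + (M + N) + 4 * g                                        ≡⟨ e₁ M N g ⟩
        ((M + N) + (g + g)) + ((M + N) + (g + g))                        ≤⟨ +-mono-≤ 2y 2y′ ⟩
        (y + y) + (y′ + y′)                                              ≤⟨ +-mono-≤ (+-mono-≤ y≤ y≤) (+-mono-≤ (big y′≤) (big y′≤)) ⟩
        ((φ + N) + (φ + N)) + ((M + (1 + φ)) + (M + (1 + φ)))            ≡⟨ e₂ M N φ ⟩
        (M + N) + (M + N) + (4 * φ + 2)                                  ∎) ⟩
      4 * φ + 2       ∎))
    where
    open ≤-Reasoning
    4≰2 : ¬ 4 ≤ 2
    4≰2 (s≤s (s≤s ()))
    big : y′ ≤ M + (β + φ) → y′ ≤ M + (1 + φ)
    big p = ≤-trans p (+-monoʳ-≤ M (+-monoˡ-≤ φ β≤))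
    e₀ : ∀ φ → 4 * φ + 4 ≡ 4 * suc φ
    e₀ = solve-∀
    e₁ : ∀ M N g → (M + N) + (M + N) + 4 * g ≡ ((M + N) + (g + g)) + ((M + N) + (g + g))
    e₁ = solve-∀
    e₂ : ∀ M N φ → ((φ + N) + (φ + N)) + ((M + (1 + φ)) + (M + (1 + φ))) ≡ (M + N) + (M + N) + (4 * φ + 2)
    e₂ = solve-∀

  -- More than half of C must be candidates for μ, so that at most |C| blocked pairs leave some
  -- candidate with at most one.
  many-candidates : ∀ {cc g φ N x} → x ≤ φ + N → cc + (g + g) ≤ x + x → φ < g → cc < N * 2
  many-candidates {cc} {g} {φ} {N} {x} x≤ 2x φ<g = ≰⇒> λ N≤ → <-irrefl refl (begin-strict
    (φ + φ) + cc            <⟨ +-monoˡ-< cc (+-mono-< φ<g φ<g) ⟩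
    (g + g) + cc            ≡⟨ +-comm (g + g) cc ⟩
    cc + (g + g)            ≤⟨ 2x ⟩
    x + x                   ≤⟨ +-mono-≤ x≤ x≤ ⟩
    (φ + N) + (φ + N)       ≡⟨ e φ N ⟩
    (φ + φ) + N * 2         ≤⟨ +-monoʳ-≤ (φ + φ) N≤ ⟩
    (φ + φ) + cc            ∎)
    where
    open ≤-Reasoning
    e : ∀ φ N → (φ + N) + (φ + N) ≡ (φ + φ) + N * 2
    e = solve-∀

  module Swaps {n m k : ℕ} (G : SimpleGraph n m) (col : Fin m → Fin k) (proper : IsProperColouring G col)
    {s : ℕ} (f : Fin s → Fin m)
    (disj : ∀ {i j} → i ≢ j → Darts.Disjoint G col proper (f i) (f j))
    (rain : Injective _≡_ _≡_ (λ i → col (f i))) (B w : ℕ)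
    (L : List (Fin s × Bool)) (chain : Stages.Chain G col proper f disj rain B w L) where
    open Darts G col proper
    open Degrees G col proper
    open Augmentation f disj rain B
    open Stages G col proper f disj rain B w
    open Stage L chain

    unused? : ∀ c → Dec (Unusedᴹ c)
    unused? c = all? (λ i → ¬? (col (f i) ≟ c))

    open Palette unused? public using (toC?; degC)

    Near : Fin n → List Item → MDart → Set
    Near v F μ = Any (λ d → (src d ≡ v × tgt d ≡ srcᴹ μ) × (Unusedᴹ (colour d) × Avoids F d)) darts

    near? : ∀ v F μ → Dec (Near v F μ)
    near? v F μ = any? (λ d → ((src d ≟ v) ×-dec (tgt d ≟ srcᴹ μ)) ×-dec (unused? (colour d) ×-dec avoids? F d)) darts

    near : Fin n → List Item → List MDart
    near v F = filter (near? v F) Cs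

    deg-≤-near : ∀ v F → deg v toC? ≤ length F + length (near v F)
    deg-≤-near v F = ≮⇒≥ λ lt → contra (pick v toC? (map (inj₁ ∘ srcᴹ) (near v F) ++ F)
        (≤-<-trans (≤-reflexive (trans (length-++ (map (inj₁ ∘ srcᴹ) (near v F)))
          (trans (cong (_+ length F) (length-map _ (near v F))) (+-comm _ (length F))))) lt))
      where
      contra : ¬ (∃ λ d → src d ≡ v × (Unusedᴹ (colour d) × InC (tgt d)) × Avoids (map (inj₁ ∘ srcᴹ) (near v F) ++ F) d)
      contra (d , e , (un , c) , v∉ , c∉) = v∉ (∈-++⁺ˡ (subst (λ z → inj₁ z ∈ _) μ≡ (∈-map⁺ (inj₁ ∘ srcᴹ)
          (∈-filter⁺ (near? v F) μ∈ (lose (∈-darts d) ((e , sym μ≡) , un , v∉ ∘ ∈-++⁺ʳ _ , c∉ ∘ ∈-++⁺ʳ _))))))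
        where
        μ∈ = proj₁ (proj₂ (find c))
        μ≡ = proj₂ (proj₂ (find c))

    -- The rotation enters the edge ν at its source and must join the other end to v (later v = y).
    -- These are thus the sources at which the second new edge may not end.
    far : Fin n → List Item → List MDart
    far v F = filter (λ ν → ¬? (near? v F (flip ν))) Cs

    far+near : ∀ v F → length (far v F) + length (near v F) ≡ length Cs
    far+near v F = begin
      length (far v F) + length (near v F)                                                ≡⟨ cong₂ _+_ (length-filter-∑ (λ ν → ¬? (near? v F (flip ν))) Cs) (length-filter-∑ (near? v F) Cs) ⟩
      ∑ Cs (λ ν → ⟦ ¬? (near? v F (flip ν)) ⟧) + ∑ Cs (λ ν → ⟦ near? v F ν ⟧)              ≡⟨ cong (∑ Cs (λ ν → ⟦ ¬? (near? v F (flip ν)) ⟧) +_) (∑-oriented-not remaining (λ ν → ⟦ near? v F ν ⟧)) ⟨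
      ∑ Cs (λ ν → ⟦ ¬? (near? v F (flip ν)) ⟧) + ∑ Cs (λ ν → ⟦ near? v F (flip ν) ⟧)       ≡⟨ ∑-+ Cs _ _ ⟨
      ∑ Cs (λ ν → ⟦ ¬? (near? v F (flip ν)) ⟧ + ⟦ near? v F (flip ν) ⟧)                    ≡⟨ ∑-cong Cs (λ ν → complement (near? v F (flip ν))) ⟩
      ∑ Cs (λ _ → 1)                                                                      ≡⟨ ∑-const Cs 1 ⟩
      length Cs * 1                                                                       ≡⟨ *-identityʳ _ ⟩
      length Cs                                                                           ∎
      where
      open ≡-Reasoning
      complement : {P : Set} (p : Dec P) → ⟦ ¬? p ⟧ + ⟦ p ⟧ ≡ 1
      complement (yes _) = refl
      complement (no  _) = refl

    module _ (g : ℕ) where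
      Bad : MDart → Set
      Bad μ = degC μ + degC μ < length Cs + (g + g)

      bad? : ∀ μ → Dec (Bad μ)
      bad? μ = degC μ + degC μ <? length Cs + (g + g)

      bads : List MDart
      bads = filter bad? Cs

      module _ (p : Fin s) (good⁺ : ¬ Bad (p , true)) (good⁻ : ¬ Bad (p , false))
               (room : length bads + (B + 5) ≤ g) (F : List Item) (F≤ : length F ≤ B) where
        private
          x y : Fin n
          x = srcᴹ (p , true)
          y = srcᴹ (p , false)

          -- For a fixed μ the coincidence c₂ = c₃ may occur at every ν; but a fixed ν is
          -- blocked for at most one μ, so some candidate μ has at most one blocked ν.
          Blocks : MDart → MDart → Set
          Blocks μ ν = Any (λ d₂ → (src d₂ ≡ tgtᴹ μ × tgt d₂ ≡ srcᴹ ν) ×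
                         Any (λ d₃ → (src d₃ ≡ y × tgt d₃ ≡ tgtᴹ ν) × colour d₂ ≡ colour d₃) darts) darts

          blocks? : ∀ μ ν → Dec (Blocks μ ν)
          blocks? μ ν = any? (λ d₂ → ((src d₂ ≟ tgtᴹ μ) ×-dec (tgt d₂ ≟ srcᴹ ν)) ×-dec
                          any? (λ d₃ → ((src d₃ ≟ y) ×-dec (tgt d₃ ≟ tgtᴹ ν)) ×-dec (colour d₂ ≟ colour d₃)) darts) darts

          blocks-unique : ∀ {μ μ′} ν → Blocks μ ν → Blocks μ′ ν → μ ≡ μ′
          blocks-unique {μ} {μ′} ν b b′ =
            trans (sym (flip-involutive μ)) (trans (cong flip (srcᴹ-injective {flip μ} {flip μ′} ends≡)) (flip-involutive μ′))
            where
            d₂ = proj₁ (find b)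
            d₂′ = proj₁ (find b′)
            e₂ = proj₁ (proj₂ (proj₂ (find b)))
            e₂′ = proj₁ (proj₂ (proj₂ (find b′)))
            d₃ = proj₁ (find (proj₂ (proj₂ (proj₂ (find b)))))
            d₃′ = proj₁ (find (proj₂ (proj₂ (proj₂ (find b′)))))
            r = proj₂ (proj₂ (find (proj₂ (proj₂ (proj₂ (find b))))))
            r′ = proj₂ (proj₂ (find (proj₂ (proj₂ (proj₂ (find b′))))))
            d₃≡ : d₃ ≡ d₃′
            d₃≡ = dart-unique-ends {d₃} {d₃′} (trans (proj₁ (proj₁ r)) (sym (proj₁ (proj₁ r′)))) (trans (proj₂ (proj₁ r)) (sym (proj₂ (proj₁ r′))))
            d₂≡ : d₂ ≡ d₂′
            d₂≡ = dart-unique-colourᵗ {d₂} {d₂′} (trans (proj₂ e₂) (sym (proj₂ e₂′)))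
                    (trans (proj₂ r) (trans (cong colour d₃≡) (sym (proj₂ r′))))
            ends≡ : tgtᴹ μ ≡ tgtᴹ μ′
            ends≡ = trans (sym (proj₁ e₂)) (trans (cong src d₂≡) (proj₁ e₂′))

          -- Besides F, the partners of the bad vertices are forbidden as sources of μ; this makes
          -- the other end of μ good.
          F₁ : List Item
          F₁ = map (inj₁ ∘ tgtᴹ) bads ++ F

          X : List MDart
          X = near x F₁

          F₁< : length F₁ < g
          F₁< = <-≤-trans (≤-<-trans (≤-reflexive (trans (length-++ (map (inj₁ ∘ tgtᴹ) bads)) (cong (_+ length F) (length-map _ bads))))
                  (+-monoʳ-< (length bads) (≤-<-trans F≤ (m<m+n B (s≤s z≤n))))) room

          X-many : length Cs < length X * 2
          X-many = many-candidates (deg-≤-near x F₁) (≮⇒≥ good⁺) F₁<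

          few-blocked : ∃ λ μ → μ ∈ X × ∑ Cs (λ ν → ⟦ blocks? μ ν ⟧) < 2
          few-blocked = ∑-<⇒∃ X (λ _ → 2) (λ μ → ∑ Cs (λ ν → ⟦ blocks? μ ν ⟧)) (begin-strict
            ∑ X (λ μ → ∑ Cs (λ ν → ⟦ blocks? μ ν ⟧))   ≡⟨ ∑-swap X Cs _ ⟩
            ∑ Cs (λ ν → ∑ X (λ μ → ⟦ blocks? μ ν ⟧))   ≤⟨ ∑-≤-length Cs (λ ν _ → one ν) ⟩
            length Cs                                   <⟨ X-many ⟩
            length X * 2                                ≡⟨ ∑-const X 2 ⟨
            ∑ X (λ _ → 2)                               ∎)
            where
            open ≤-Reasoning
            one : ∀ ν → ∑ X (λ μ → ⟦ blocks? μ ν ⟧) ≤ 1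
            one ν = ∑-atMostOne (Unique.filter⁺ (near? x F₁) Cs-unique) (λ μ → ⟦⟧≤1 (blocks? μ ν)) λ {μ} {μ′} _ _ u u′ →
              blocks-unique ν (⟦⟧-positive (blocks? μ ν) u) (⟦⟧-positive (blocks? μ′ ν) u′)

          μ : MDart
          μ = proj₁ few-blocked

          μ∈X : μ ∈ Cs × Near x F₁ μ
          μ∈X = ∈-filter⁻ (near? x F₁) {xs = Cs} (proj₁ (proj₂ few-blocked))

          d₁ : Dart
          d₁ = proj₁ (find (proj₂ μ∈X))

          d₁-spec : (src d₁ ≡ x × tgt d₁ ≡ srcᴹ μ) × (Unusedᴹ (colour d₁) × Avoids F₁ d₁)
          d₁-spec = proj₂ (proj₂ (find (proj₂ μ∈X)))

          μ∉F₁ : inj₁ (srcᴹ μ) ∉ F₁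
          μ∉F₁ = subst (λ v → inj₁ v ∉ F₁) (proj₂ (proj₁ d₁-spec)) (proj₁ (proj₂ (proj₂ d₁-spec)))

          good-flip : ¬ Bad (flip μ)
          good-flip b = μ∉F₁ (∈-++⁺ˡ (subst (λ ν → inj₁ (srcᴹ ν) ∈ map (inj₁ ∘ tgtᴹ) bads) (flip-involutive μ)
                          (∈-map⁺ (inj₁ ∘ tgtᴹ) (∈-filter⁺ bad? (Cs-flip (proj₁ μ∈X)) b))))

          -- Both ends of μ keep ν on another edge, and the colour of `d₁` keeps the other two
          -- colours different from it.
          F₂ : List Item
          F₂ = inj₁ (srcᴹ μ) ∷ inj₁ (tgtᴹ μ) ∷ inj₂ (colour d₁) ∷ F

          blocked : List MDart
          blocked = filter (blocks? μ) Cs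

          -- Avoiding this list when leaving the other end of μ settles everything at once: the
          -- partner of ν can be joined to y, the second and third colours differ, and nothing in F₂
          -- is reused.
          F₃ : List Item
          F₃ = map (inj₁ ∘ srcᴹ) (far y F₂) ++ (map (inj₁ ∘ srcᴹ) blocked ++ F₂)

          F₃-size : length F₃ ≡ length (far y F₂) + (length blocked + length F₂)
          F₃-size = trans (length-++ (map (inj₁ ∘ srcᴹ) (far y F₂))) (cong₂ _+_ (length-map _ (far y F₂))
                      (trans (length-++ (map (inj₁ ∘ srcᴹ) blocked)) (cong (_+ length F₂) (length-map _ blocked))))

          F₂< : length F₂ < g
          F₂< = <-≤-trans (<-≤-trans (s≤s (+-monoʳ-≤ 3 F≤)) (≤-trans (≤-reflexive (+-comm 4 B)) (+-monoʳ-≤ B (n≤1+n 4))))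
                          (≤-trans (m≤n+m (B + 5) (length bads)) room)

          F₃< : length F₃ < degC (flip μ)
          F₃< = ≤-<-trans (≤-reflexive F₃-size)
                  (count-bound (far+near y F₂) (deg-≤-near y F₂) (≮⇒≥ good⁻) (≮⇒≥ good-flip) blocked≤1 F₂<)
            where
            blocked≤1 : length blocked ≤ 1
            blocked≤1 = ≤-trans (≤-reflexive (length-filter-∑ (blocks? μ) Cs)) (s≤s⁻¹ (proj₂ (proj₂ few-blocked)))

          finish : (∃ λ d → src d ≡ tgtᴹ μ × (Unusedᴹ (colour d) × InC (tgt d)) × Avoids F₃ d) → Swap p F
          finish (d₂ , e₂ , (un₂ , inC) , v₂∉ , c₂∉) = record
            { μ = μ ; ν = ν ; d₁ = d₁ ; d₂ = d₂ ; d₃ = d₃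
            ; src₁ = proj₁ (proj₁ d₁-spec) ; tgt₁ = proj₂ (proj₁ d₁-spec)
            ; src₂ = e₂ ; tgt₂ = sym ν≡
            ; src₃ = proj₁ (proj₁ d₃-spec) ; tgt₃ = proj₂ (proj₁ d₃-spec)
            ; μ∉F = μ∉F₁ ∘ ∈-++⁺ʳ _
            ; ν∉F = ν∉F₂ ∘ F⊆F₂
            ; μ≢ν = distinct μ ν (ν∉F₂ ∘ here ∘ cong inj₁) (ν∉F₂ ∘ there ∘ here ∘ cong inj₁)
            ; new₁ = proj₁ (proj₂ d₁-spec) , proj₂ (proj₂ (proj₂ d₁-spec)) ∘ ∈-++⁺ʳ _
            ; new₂ = un₂ , c₂∉ ∘ F₂⊆F₃ ∘ F⊆F₂
            ; new₃ = proj₁ (proj₂ d₃-spec) , c₃∉ ∘ F⊆F₂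
            ; c₁≢c₂ = λ e → c₂∉ (F₂⊆F₃ (there (there (here (cong inj₂ (sym e))))))
            ; c₁≢c₃ = λ e → c₃∉ (there (there (here (cong inj₂ (sym e)))))
            ; c₂≢c₃ = λ e → ¬blocked (lose (∈-darts d₂) ((e₂ , sym ν≡) , lose (∈-darts d₃) (proj₁ d₃-spec , e)))
            }
            where
            ν : MDart
            ν = proj₁ (find inC)
            ν∈ : ν ∈ Cs
            ν∈ = proj₁ (proj₂ (find inC))
            ν≡ : srcᴹ ν ≡ tgt d₂
            ν≡ = proj₂ (proj₂ (find inC))
            F⊆F₂ : ∀ {z} → z ∈ F → z ∈ F₂
            F⊆F₂ q = there (there (there q))
            F₂⊆F₃ : ∀ {z} → z ∈ F₂ → z ∈ F₃
            F₂⊆F₃ q = ∈-++⁺ʳ (map (inj₁ ∘ srcᴹ) (far y F₂)) (∈-++⁺ʳ (map (inj₁ ∘ srcᴹ) blocked) q)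
            ν∉F₃ : inj₁ (srcᴹ ν) ∉ F₃
            ν∉F₃ = subst (λ v → inj₁ v ∉ F₃) (sym ν≡) v₂∉
            ν∉F₂ : inj₁ (srcᴹ ν) ∉ F₂
            ν∉F₂ = ν∉F₃ ∘ F₂⊆F₃
            ¬blocked : ¬ Blocks μ ν
            ¬blocked b = ν∉F₃ (∈-++⁺ʳ (map (inj₁ ∘ srcᴹ) (far y F₂)) (∈-++⁺ˡ (∈-map⁺ (inj₁ ∘ srcᴹ) (∈-filter⁺ (blocks? μ) ν∈ b))))
            is-near : Near y F₂ (flip ν)
            is-near = decidable-stable (near? y F₂ (flip ν)) λ ¬near →
              ν∉F₃ (∈-++⁺ˡ (∈-map⁺ (inj₁ ∘ srcᴹ) (∈-filter⁺ (λ ν → ¬? (near? y F₂ (flip ν))) ν∈ ¬near)))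
            d₃ : Dart
            d₃ = proj₁ (find is-near)
            d₃-spec : (src d₃ ≡ y × tgt d₃ ≡ tgtᴹ ν) × (Unusedᴹ (colour d₃) × Avoids F₂ d₃)
            d₃-spec = proj₂ (proj₂ (find is-near))
            c₃∉ : inj₂ (colour d₃) ∉ F₂
            c₃∉ = proj₂ (proj₂ (proj₂ d₃-spec))
            distinct : ∀ μ ν → srcᴹ ν ≢ srcᴹ μ → srcᴹ ν ≢ tgtᴹ μ → proj₁ μ ≢ proj₁ ν
            distinct (i , true)  (.i , true)  h h′ refl = h refl
            distinct (i , true)  (.i , false) h h′ refl = h′ refl
            distinct (i , false) (.i , true)  h h′ refl = h′ refl
            distinct (i , false) (.i , false) h h′ refl = h refl

        good⇒swap : Swap p F
        good⇒swap = finish (pick (tgtᴹ μ) toC? F₃ F₃<)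

  -- Inequalities for the two palettes

  -- C has 2a vertices of degree at most `size`, and each of the b bad ones falls short of `size` by
  -- at least e. The count forces the degree sum C to be within 2R of 2 * (q - l) * size, hence of 2
  -- * a * size, so the total deficit e * b is at most 2R ≤ 4 * a * h.
  bad-bound : ∀ {q l a h e b size C R} → l + a ≤ q →
              size * (q + q) ≤ (l * size + l * size) + (C + (R + R)) → R ≤ (a + a) * h →
              (C + C) + (e + e) * b ≤ (a + a) * (size + size) → e * b ≤ 4 * (q * h)
  bad-bound {q} {l} {a} {h} {e} {b} {size} {C} {R} la≤q count R≤ weighted =
    *-cancelˡ-≤ 2 (+-cancelˡ-≤ (4 * (q * size)) _ _ (begin
      4 * (q * size) + 2 * (e * b)                                          ≡⟨ e₁ q size e b ⟩
      (size * (q + q) + size * (q + q)) + (e + e) * b                       ≤⟨ +-monoˡ-≤ _ (+-mono-≤ count count) ⟩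
      (((l * size + l * size) + (C + (R + R))) + ((l * size + l * size) + (C + (R + R)))) + (e + e) * b
                                                                            ≡⟨ e₂ l size C R (e + e) b ⟩
      4 * (l * size) + ((C + C) + (e + e) * b) + 4 * R                      ≤⟨ +-mono-≤ (+-monoʳ-≤ (4 * (l * size)) weighted) (*-monoʳ-≤ 4 R≤) ⟩
      4 * (l * size) + (a + a) * (size + size) + 4 * ((a + a) * h)          ≡⟨ e₃ l a size h ⟩
      4 * ((l + a) * size) + 2 * (4 * (a * h))                              ≤⟨ +-mono-≤ (*-monoʳ-≤ 4 (*-monoˡ-≤ size la≤q)) (*-monoʳ-≤ 2 (*-monoʳ-≤ 4 (*-monoˡ-≤ h (≤-trans (m≤n+m a l) la≤q)))) ⟩
      4 * (q * size) + 2 * (4 * (q * h))                                    ∎))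
    where
    open ≤-Reasoning
    e₁ : ∀ q s e b → 4 * (q * s) + 2 * (e * b) ≡ (s * (q + q) + s * (q + q)) + (e + e) * b
    e₁ = solve-∀
    e₂ : ∀ l s C R e b → (((l * s + l * s) + (C + (R + R))) + ((l * s + l * s) + (C + (R + R)))) + e * b ≡
                         4 * (l * s) + ((C + C) + e * b) + 4 * R
    e₂ = solve-∀
    e₃ : ∀ l a s h → 4 * (l * s) + (a + a) * (s + s) + 4 * ((a + a) * h) ≡ 4 * ((l + a) * s) + 2 * (4 * (a * h))
    e₃ = solve-∀

  -- After subtracting the darts at A, at least 2 * (a + 1) * size darts remain, but C can account
  -- for at most 2a * (2a + 2h), which is no more than 2a * size.
  overfull : ∀ {q l a h size C R} → l + a < q →
             size * (q + q) ≤ (l * size + l * size) + (C + (R + R)) → C ≤ (a + a) * (a + a) → R ≤ (a + a) * h →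
             (a + a) + (h + h) < size → ⊥
  overfull {q} {l} {a} {h} {size} {C} {R} la<q count C≤ R≤ big = n≮0 (≤-trans big
    (≤-trans (m≤m+n size size) (+-cancelˡ-≤ (2 * ((l + a) * size)) _ _ (begin
      2 * ((l + a) * size) + (size + size)                       ≡⟨ e₁ l a size ⟩
      size * (suc (l + a) + suc (l + a))                         ≤⟨ *-monoʳ-≤ size (+-mono-≤ la<q la<q) ⟩
      size * (q + q)                                             ≤⟨ count ⟩
      (l * size + l * size) + (C + (R + R))                      ≤⟨ +-monoʳ-≤ (l * size + l * size) (+-mono-≤ C≤ (+-mono-≤ R≤ R≤)) ⟩
      (l * size + l * size) + ((a + a) * (a + a) + ((a + a) * h + (a + a) * h))
                                                                 ≡⟨ e₂ l a size h ⟩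
      (l * size + l * size) + (a + a) * ((a + a) + (h + h))      ≤⟨ +-monoʳ-≤ (l * size + l * size) (*-monoʳ-≤ (a + a) (<⇒≤ big)) ⟩
      (l * size + l * size) + (a + a) * size                     ≡⟨ e₃ l a size ⟩
      2 * ((l + a) * size) + 0                                   ∎))))
    where
    open ≤-Reasoning
    e₁ : ∀ l a s → 2 * ((l + a) * s) + (s + s) ≡ s * (suc (l + a) + suc (l + a))
    e₁ = solve-∀
    e₂ : ∀ l a s h → (l * s + l * s) + ((a + a) * (a + a) + ((a + a) * h + (a + a) * h)) ≡
                     (l * s + l * s) + (a + a) * ((a + a) + (h + h))
    e₂ = solve-∀
    e₃ : ∀ l a s → (l * s + l * s) + (a + a) * s ≡ 2 * ((l + a) * s) + 0
    e₃ = solve-∀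

  -- Here the factor 2 in the number of colours is spent: one q covers l + a, the other covers the
  -- second a, and 2e covers the bad vertices and 2h.
  palette-large : ∀ {q l a h e b k size} → l + a < q → q + q + (e + e) ≤ k → b + (h + h) ≤ e + e →
                  k ≤ size + (l + b) → (a + a) + (h + h) < size
  palette-large {q} {l} {a} {h} {e} {b} {k} {size} la<q k≥ bh≤ k≤ = +-cancelʳ-≤ (l + b) _ _ (begin
    suc ((a + a) + (h + h)) + (l + b)           ≡⟨ e₁ a h l b ⟩
    (suc (l + a) + a) + (b + (h + h))           ≤⟨ +-mono-≤ (+-mono-≤ la<q (≤-trans (m≤n+m a l) (<⇒≤ la<q))) bh≤ ⟩
    (q + q) + (e + e)                           ≤⟨ k≥ ⟩
    k                                           ≤⟨ k≤ ⟩
    size + (l + b)                              ∎)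
    where
    open ≤-Reasoning
    e₁ : ∀ a h l b → suc ((a + a) + (h + h)) + (l + b) ≡ (suc (l + a) + a) + (b + (h + h))
    e₁ = solve-∀

  -- Enlarging a rainbow matching by one edge

  module Round {n m k : ℕ} (G : SimpleGraph n m) (col : Fin m → Fin k) (proper : IsProperColouring G col)
    {q e w ℓ B : ℕ} (often : ∀ c → AppearsAtLeast col q c)
    (colours : q + q + (e + e) ≤ k)
    (levels : q ≤ ℓ * w) (budget : 27 + (ℓ * 24 + ℓ * 24) ≤ B) (B<w : B < w)
    (few-bads : ∀ b → e * b ≤ 4 * (q * (w + w)) → b + (B + 5) ≤ e)
    (slack : ∀ b → b ≤ e → b + ((w + w) + (w + w)) ≤ e + e)
    {s : ℕ} (s<q : s < q) (f : Fin s → Fin m)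
    (disj : ∀ {i j} → i ≢ j → Darts.Disjoint G col proper (f i) (f j))
    (rain : Injective _≡_ _≡_ (λ i → col (f i))) where
    open Darts G col proper
    open Degrees G col proper
    open Augmentation f disj rain B
    open Stages G col proper f disj rain B w

    module _ (L : List MDart) (chain : Chain L) where
      open Stage L chain
      open Swaps G col proper f disj rain B w L chain
      private
        a l : ℕ
        a = length remaining
        l = length L

        l+a≤s : l + a ≤ s
        l+a≤s = ≤-trans (≤-reflexive (+-comm l a)) remaining+chain

        module _ {D : Fin k → Set} (D? : ∀ c → Dec (D c)) where
          degC≤size : ∀ μ → Palette.degC D? μ ≤ Palette.size D?
          degC≤size μ = ≤-trans (∑-mono darts λ d → ⟦⟧-bound ((src d ≟ srcᴹ μ) ×-dec Palette.toC? D? d)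
                          λ (p , Dd , _) → ≤-reflexive (sym (⟦⟧-true ((src d ≟ srcᴹ μ) ×-dec D? (colour d)) (p , Dd))))
                          (deg-≤-palette D? (srcᴹ μ))

          degC≤Cs : ∀ μ → Palette.degC D? μ ≤ length Cs
          degC≤Cs μ = ≮⇒≥ λ lt → contra (pick (srcᴹ μ) (Palette.toC? D?) (map (inj₁ ∘ srcᴹ) Cs)
                        (≤-<-trans (≤-reflexive (length-map _ Cs)) lt))
            where
            contra : ¬ (∃ λ d → src d ≡ srcᴹ μ × (D (colour d) × InC (tgt d)) × Avoids (map (inj₁ ∘ srcᴹ) Cs) d)
            contra (d , _ , (_ , c) , v∉ , _) with ν , ν∈ , eq ← find c =
              v∉ (subst (λ v → inj₁ v ∈ map (inj₁ ∘ srcᴹ) Cs) eq (∈-map⁺ (inj₁ ∘ srcᴹ) ν∈))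

          sum-degR : ∀ {h} → (∀ μ → μ ∈ Cs → Palette.degR D? μ ≤ h) → ∑ Cs (Palette.degR D?) ≤ (a + a) * h
          sum-degR {h} small = ≤-trans (∑-≤-const Cs h small) (≤-reflexive (cong (_* h) length-Cs))

        ∑-colour : ∀ {A : Set} (xs : List A) (c : A → Fin k) → ∑ (allFin k) (λ c′ → ∑ xs (λ x → ⟦ c x ≟ c′ ⟧)) ≤ length xs
        ∑-colour xs c = ≤-trans (≤-reflexive (∑-swap (allFin k) xs _)) (∑-≤-length xs λ x _ →
          ∑-atMostOne (Unique.allFin⁺ k) (λ c′ → ⟦⟧≤1 (c x ≟ c′)) λ {c′} {c″} _ _ p p′ →
            trans (sym (⟦⟧-positive (c x ≟ c′) p)) (⟦⟧-positive (c x ≟ c″) p′))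

        ∑-colour-term : ∀ {A : Set} (xs : List A) (c : A → Fin k) {x} → x ∈ xs → 1 ≤ ∑ xs (λ y → ⟦ c y ≟ c x ⟧)
        ∑-colour-term xs c {x} x∈ = ≤-trans (≤-reflexive (sym (⟦⟧-true (c x ≟ c x) refl))) (∑-term xs (λ y → ⟦ c y ≟ c x ⟧) x∈)

        colours-total : k ≡ ∑ (allFin k) (λ _ → 1)
        colours-total = sym (trans (∑-const (allFin k) 1) (trans (*-identityʳ _) (length-tabulate (λ c → c))))

        unused-many : q + (e + e) ≤ Palette.size unused?
        unused-many = +-cancelʳ-≤ q _ _ (begin
          q + (e + e) + q                                                                    ≡⟨ rearrange q e ⟩
          q + q + (e + e)                                                                    ≤⟨ colours ⟩
          k                                                                                  ≡⟨ colours-total ⟩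
          ∑ (allFin k) (λ _ → 1)                                                             ≤⟨ ∑-mono (allFin k) pointwise ⟩
          ∑ (allFin k) (λ c → ⟦ unused? c ⟧ + ∑ (allFin s) (λ i → ⟦ col (f i) ≟ c ⟧))              ≡⟨ ∑-+ (allFin k) _ _ ⟩
          ∑ (allFin k) (λ c → ⟦ unused? c ⟧) + ∑ (allFin k) (λ c → ∑ (allFin s) (λ i → ⟦ col (f i) ≟ c ⟧))
            ≤⟨ +-mono-≤ (≤-reflexive (sym (length-filter-∑ unused? (allFin k)))) (∑-colour (allFin s) (col ∘ f)) ⟩
          Palette.size unused? + length (allFin s)                                                ≤⟨ +-monoʳ-≤ _ (≤-trans (≤-reflexive (length-tabulate {n = s} (λ i → i))) (<⇒≤ s<q)) ⟩
          Palette.size unused? + q                                                           ∎)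
          where
          open ≤-Reasoning
          rearrange : ∀ q e → q + (e + e) + q ≡ q + q + (e + e)
          rearrange = solve-∀
          pointwise : ∀ c → 1 ≤ ⟦ unused? c ⟧ + ∑ (allFin s) (λ i → ⟦ col (f i) ≟ c ⟧)
          pointwise c with unused? c
          ... | yes _ = s≤s z≤n
          ... | no ¬un with any? (λ i → col (f i) ≟ c) (allFin s)
          ...   | no ¬a = ⊥-elim (¬un λ i eq → ¬a (lose (∈-allFin i) eq))
          ...   | yes u with i , i∈ , refl ← find u = ∑-colour-term (allFin s) (col ∘ f) i∈

        weighted : (∑ Cs degC + ∑ Cs degC) + (e + e) * length (bads e) ≤ (a + a) * (Palette.size unused? + Palette.size unused?)
        weighted = begin
          (∑ Cs degC + ∑ Cs degC) + (e + e) * length (bads e)                   ≡⟨ cong₂ _+_ (∑-+ Cs degC degC) (trans (∑-*ˡ Cs (e + e) _) (cong ((e + e) *_) (sym (length-filter-∑ (bad? e) Cs)))) ⟨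
          ∑ Cs (λ μ → degC μ + degC μ) + ∑ Cs (λ μ → (e + e) * ⟦ bad? e μ ⟧)     ≡⟨ ∑-+ Cs _ _ ⟨
          ∑ Cs (λ μ → (degC μ + degC μ) + (e + e) * ⟦ bad? e μ ⟧)                ≤⟨ ∑-≤-const Cs _ (λ μ _ → each μ) ⟩
          length Cs * (size + size)                                             ≡⟨ cong (_* (size + size)) length-Cs ⟩
          (a + a) * (size + size)                                               ∎
          where
          open ≤-Reasoning
          size : ℕ
          size = Palette.size unused?
          each : ∀ μ → (degC μ + degC μ) + (e + e) * ⟦ bad? e μ ⟧ ≤ size + size
          each μ with bad? e μ
          ... | no _ = ≤-trans (≤-reflexive (trans (cong ((degC μ + degC μ) +_) (*-zeroʳ (e + e))) (+-identityʳ _)))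
                         (+-mono-≤ (degC≤size unused? μ) (degC≤size unused? μ))
          -- A bad vertex has 2 * degC below 2a + 2e, and `size` is at least q + 2e ≥ a + 2e, so its
          -- doubled degree leaves room for the weight 2e.
          ... | yes b = begin
            (degC μ + degC μ) + (e + e) * 1                ≤⟨ +-mono-≤ (<⇒≤ b) (≤-reflexive (*-identityʳ (e + e))) ⟩
            (length Cs + (e + e)) + (e + e)                ≡⟨ cong (λ z → (z + (e + e)) + (e + e)) length-Cs ⟩
            ((a + a) + (e + e)) + (e + e)                  ≤⟨ +-monoˡ-≤ (e + e) (+-monoˡ-≤ (e + e) (+-mono-≤ a≤q a≤q)) ⟩
            ((q + q) + (e + e)) + (e + e)                  ≡⟨ rearrange q e ⟩
            (q + (e + e)) + (q + (e + e))                  ≤⟨ +-mono-≤ unused-many unused-many ⟩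
            size + size                                    ∎
            where
            a≤q : a ≤ q
            a≤q = ≤-trans (m≤n+m a l) (≤-trans l+a≤s (<⇒≤ s<q))
            rearrange : ∀ q e → ((q + q) + (e + e)) + (e + e) ≡ (q + (e + e)) + (q + (e + e))
            rearrange = solve-∀

        Swappable : Fin s → Set
        Swappable p = ¬ Bad e (p , true) × ¬ Bad e (p , false)

        -- A decidable stand-in for `FreeColour`, which quantifies over all lists F and so cannot be
        -- used to filter colours. `available-free` links the two once few vertices are bad.
        Available : Fin k → Set
        Available c = Unusedᴹ c ⊎ Any (λ p → Swappable p × col (f p) ≡ c) remaining

        available? : ∀ c → Dec (Available c)
        available? c = unused? c ⊎-dec any? (λ p → (¬? (bad? e (p , true)) ×-dec ¬? (bad? e (p , false))) ×-dec (col (f p) ≟ c)) remaining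

        available-many : k ≤ Palette.size available? + (l + length (bads e))
        available-many = begin
          k                                                              ≡⟨ colours-total ⟩
          ∑ (allFin k) (λ _ → 1)                                         ≤⟨ ∑-mono (allFin k) pointwise ⟩
          ∑ (allFin k) (λ c → δ c + (λᴸ c + β c))                        ≡⟨ trans (∑-+ (allFin k) δ _) (cong (∑ (allFin k) δ +_) (∑-+ (allFin k) λᴸ β)) ⟩
          ∑ (allFin k) δ + (∑ (allFin k) λᴸ + ∑ (allFin k) β)            ≤⟨ +-mono-≤ (≤-reflexive (sym (length-filter-∑ available? (allFin k))))
                                                                              (+-mono-≤ (∑-colour L colᴹ) (∑-colour (bads e) colᴹ)) ⟩
          Palette.size available? + (l + length (bads e))                ∎
          where
          open ≤-Reasoning
          colᴹ : MDart → Fin k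
          colᴹ μ = col (f (proj₁ μ))
          δ λᴸ β : Fin k → ℕ
          δ c = ⟦ available? c ⟧
          λᴸ c = ∑ L (λ ν → ⟦ colᴹ ν ≟ c ⟧)
          β c = ∑ (bads e) (λ ν → ⟦ colᴹ ν ≟ c ⟧)
          open Dec∈ {A = Fin s} _≟_ using (_∈?_)
          by-index : ∀ p → 1 ≤ δ (col (f p)) + (λᴸ (col (f p)) + β (col (f p)))
          by-index p with p ∈? idx
          ... | yes p∈ with ν , ν∈ , refl ← ∈-map⁻ proj₁ p∈ =
                ≤-trans (∑-colour-term L colᴹ ν∈) (≤-trans (m≤m+n _ (β (colᴹ ν))) (m≤n+m _ (δ (colᴹ ν))))
          ... | no p∉ = by-cases (bad? e (p , true)) (bad? e (p , false))
            where
            bad-case : ∀ o → Bad e (p , o) → 1 ≤ δ (col (f p)) + (λᴸ (col (f p)) + β (col (f p)))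
            bad-case o b = ≤-trans (∑-colour-term (bads e) colᴹ {p , o} (∈-filter⁺ (bad? e) (Cs⁺ p∉) b))
                             (≤-trans (m≤n+m _ (λᴸ (col (f p)))) (m≤n+m _ (δ (col (f p)))))
            by-cases : Dec (Bad e (p , true)) → Dec (Bad e (p , false)) → 1 ≤ δ (col (f p)) + (λᴸ (col (f p)) + β (col (f p)))
            by-cases (yes b) _ = bad-case true b
            by-cases (no _) (yes b) = bad-case false b
            by-cases (no g) (no g′) = ≤-trans (≤-reflexive (sym (⟦⟧-true (available? (col (f p)))
                (inj₂ (lose (remaining⁺ p∉) ((g , g′) , refl)))))) (m≤m+n _ _)
          pointwise : ∀ c → 1 ≤ δ c + (λᴸ c + β c)
          pointwise c = by-cases (unused? c) (any? (λ i → col (f i) ≟ c) (allFin s))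
            where
            by-cases : Dec (Unusedᴹ c) → Dec (Any (λ i → col (f i) ≡ c) (allFin s)) → 1 ≤ δ c + (λᴸ c + β c)
            by-cases (yes un) _ = ≤-trans (≤-reflexive (sym (⟦⟧-true (available? c) (inj₁ un)))) (m≤m+n _ _)
            by-cases (no ¬un) (no ¬a) = ⊥-elim (¬un λ i eq → ¬a (lose (∈-allFin i) eq))
            by-cases (no ¬un) (yes u) with i , _ , refl ← find u = by-index i

        short : l ≤ ℓ * w
        short = ≤-trans (m≤m+n l a) (≤-trans l+a≤s (≤-trans (<⇒≤ s<q) levels))

        Outcome : Set
        Outcome = HasRainbowMatching G col (suc s) ⊎ (∃ λ μ → Chain (μ ∷ L))

        module _ (inner : Palette.NoInner unused?) (small : ∀ μ → μ ∈ Cs → Palette.degR unused? μ ≤ w + w) where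
          room : length (bads e) + (B + 5) ≤ e
          room = few-bads (length (bads e)) (bad-bound {q} {l} {a} {w + w} {e} {length (bads e)} {Palette.size unused?} {∑ Cs degC} {∑ Cs (Palette.degR unused?)} (≤-trans l+a≤s (<⇒≤ s<q)) (Palette.double-count unused? inner often)
                   (sum-degR unused? small) weighted)

          available-free : ∀ c → Available c → FreeColour c
          available-free c (inj₁ un) = inj₁ un
          available-free c (inj₂ u) with p , _ , (g , g′) , eq ← find u =
            inj₂ (p , eq , λ F F≤ → good⇒swap e p g g′ room F F≤)

          absurd : Palette.NoInner available? → (∀ μ → μ ∈ Cs → Palette.degR available? μ ≤ w + w) → ⊥
          absurd inner′ small′ = overfull {q} {l} {a} {w + w} {Palette.size available?} {∑ Cs (Palette.degC available?)} {∑ Cs (Palette.degR available?)} (≤-<-trans l+a≤s s<q) (Palette.double-count available? inner′ often)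
            (≤-trans (∑-≤-const Cs (length Cs) λ μ _ → degC≤Cs available? μ) (≤-reflexive (cong₂ _*_ length-Cs length-Cs)))
            (sum-degR available? small′)
            (palette-large {q} {l} {a} {w + w} {e} {length (bads e)} {k} {Palette.size available?} (≤-<-trans l+a≤s s<q) colours
              (slack (length (bads e)) (≤-trans (m≤m+n _ (B + 5)) room)) available-many)

          second : Outcome
          second with Palette.progress available? {ℓ} available-free B<w short budget
          ... | inj₁ r = inj₁ r
          ... | inj₂ (inj₁ r) = inj₂ r
          ... | inj₂ (inj₂ (inner′ , small′)) = ⊥-elim (absurd inner′ small′)

      advance : HasRainbowMatching G col (suc s) ⊎ (∃ λ μ → Chain (μ ∷ L))
      advance with Palette.progress unused? {ℓ} (λ _ → inj₁) B<w short budget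
      ... | inj₁ r = inj₁ r
      ... | inj₂ (inj₁ r) = inj₂ r
      ... | inj₂ (inj₂ (inner , small)) = second inner small

    chains : ∀ j → HasRainbowMatching G col (suc s) ⊎ ∃ λ L → Chain L × length L ≡ j
    chains zero = inj₂ ([] , [] , refl)
    chains (suc j) with chains j
    ... | inj₁ r = inj₁ r
    ... | inj₂ (L , c , refl) with advance L c
    ...   | inj₁ r = inj₁ r
    ...   | inj₂ (μ , c′) = inj₂ (μ ∷ L , c′ , refl)

    enlarge : HasRainbowMatching G col (suc s)
    enlarge with chains (suc s)
    ... | inj₁ r = r
    -- The links are distinct matching edges, so a chain cannot have s + 1 of them.
    ... | inj₂ (L , c , eq) = ⊥-elim (<-irrefl refl (≤-trans (≤-reflexive (sym eq)) (≤-trans (m≤n+m (length L) _) (Stage.remaining+chain L c))))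

  -- Choice of the constants

  module Parameters (K : ℕ) .{{_ : NonZero K}} where
    Q : ℕ
    Q = 32 * (K * K)

    instance
      Q-nonZero : NonZero Q
      Q-nonZero = m*n≢0 32 (K * K) {{_}} {{m*n≢0 K K}}

    ℓ B N : ℕ
    -- Since w is q/Q rounded down, Q levels of w links may fall short of q; with w positive, 2Q
    -- levels suffice. The bound N then makes w at least B + 5, which is possible because B depends
    -- on K alone.
    ℓ = Q + Q
    B = 27 + (ℓ * 24 + ℓ * 24)
    N = (B + 5) * Q

    module _ {q : ℕ} (q≥N : N ≤ q) where
      -- The value of e is chosen so that K * e = w * Q ≤ q, that is e ≤ q/K, while e is still 32K
      -- times w and dominates all losses of order w.
      w e : ℕ
      w = q / Q
      e = 32 * (K * w)

      w-large : B + 5 ≤ w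
      w-large = ≤-trans (≤-reflexive (sym (m*n/n≡m (B + 5) Q))) (/-monoˡ-≤ Q q≥N)

      B<w : B < w
      B<w = ≤-trans (≤-reflexive (+-comm 1 B)) (≤-trans (+-monoʳ-≤ B (s≤s z≤n)) w-large)

      0<w : 0 < w
      0<w = ≤-trans (s≤s z≤n) B<w

      q≤ℓw : q ≤ ℓ * w
      q≤ℓw = begin
        q                      ≡⟨ m≡m%n+[m/n]*n q Q ⟩
        q % Q + w * Q           ≤⟨ +-monoˡ-≤ (w * Q) (<⇒≤ (m%n<n q Q)) ⟩
        Q + w * Q              ≤⟨ +-monoˡ-≤ (w * Q) (≤-trans (≤-reflexive (sym (*-identityˡ Q))) (*-monoˡ-≤ Q 0<w)) ⟩
        w * Q + w * Q          ≡⟨ lemma w Q ⟩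
        ℓ * w                  ∎
        where
        open ≤-Reasoning
        lemma : ∀ w Q → w * Q + w * Q ≡ (Q + Q) * w
        lemma = solve-∀

      K*e≤q : K * e ≤ q
      K*e≤q = ≤-trans (≤-reflexive (lemma K w)) (m/n*n≤m q Q)
        where
        lemma : ∀ K w → K * (32 * (K * w)) ≡ w * (32 * (K * K))
        lemma = solve-∀

      w≤Kw : w ≤ K * w
      w≤Kw = ≤-trans (≤-reflexive (sym (*-identityˡ w))) (*-monoˡ-≤ w (>-nonZero⁻¹ K))

      -- With q ≤ 64K²w the hypothesis reads e * b ≤ 512K²w² = e * 16Kw. So b is at most e/2, and
      -- the other half of e exceeds w ≥ B + 5.
      few-bads : ∀ b → e * b ≤ 4 * (q * (w + w)) → b + (B + 5) ≤ e
      few-bads b eb≤ = begin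
        b + (B + 5)                   ≤⟨ +-mono-≤ b≤ (≤-trans w-large w≤Kw) ⟩
        16 * (K * w) + K * w          ≤⟨ +-monoʳ-≤ (16 * (K * w)) (m≤m+n (K * w) (15 * (K * w))) ⟩
        16 * (K * w) + (K * w + 15 * (K * w)) ≡⟨ lemma′ (K * w) ⟩
        e                             ∎
        where
        open ≤-Reasoning
        lemma : ∀ K w → 4 * ((32 * (K * K) + 32 * (K * K)) * w * (w + w)) ≡ (32 * (K * w)) * (16 * (K * w))
        lemma = solve-∀
        lemma′ : ∀ x → 16 * x + (x + 15 * x) ≡ 32 * x
        lemma′ = solve-∀
        instance
          w≢0 : NonZero w
          w≢0 = >-nonZero 0<w
          Kw≢0 : NonZero (K * w)
          Kw≢0 = m*n≢0 K w
          e≢0 : NonZero e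
          e≢0 = m*n≢0 32 (K * w)
        b≤ : b ≤ 16 * (K * w)
        b≤ = *-cancelˡ-≤ e (≤-trans eb≤ (≤-trans (*-monoʳ-≤ 4 (*-monoˡ-≤ (w + w) q≤ℓw)) (≤-reflexive (lemma K w))))

      slack : ∀ b → b ≤ e → b + ((w + w) + (w + w)) ≤ e + e
      slack b b≤e = +-mono-≤ b≤e (begin
        (w + w) + (w + w)             ≤⟨ +-mono-≤ (+-mono-≤ w≤Kw w≤Kw) (+-mono-≤ w≤Kw w≤Kw) ⟩
        (K * w + K * w) + (K * w + K * w) ≤⟨ m≤m+n _ (28 * (K * w)) ⟩
        (K * w + K * w) + (K * w + K * w) + 28 * (K * w) ≡⟨ lemma (K * w) ⟩
        e                             ∎)
        where
        open ≤-Reasoning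
        lemma : ∀ x → (x + x) + (x + x) + 28 * x ≡ 32 * x
        lemma = solve-∀

      colours : ∀ {k} → 2 * (K + 1) * q ≤ K * k → q + q + (e + e) ≤ k
      colours {k} h = *-cancelˡ-≤ K (begin
        K * (q + q + (e + e))                 ≡⟨ lemma K q e ⟩
        2 * (K * q) + (K * e + K * e)         ≤⟨ +-monoʳ-≤ (2 * (K * q)) (+-mono-≤ K*e≤q K*e≤q) ⟩
        2 * (K * q) + (q + q)                 ≡⟨ lemma′ K q ⟩
        2 * (K + 1) * q                       ≤⟨ h ⟩
        K * k                                 ∎)
        where
        open ≤-Reasoning
        lemma : ∀ K q e → K * (q + q + (e + e)) ≡ 2 * (K * q) + (K * e + K * e)
        lemma = solve-∀
        lemma′ : ∀ K q → 2 * (K * q) + (q + q) ≡ 2 * (K + 1) * q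
        lemma′ = solve-∀

  -- Induction on the size of the matching

  module _ {n m k : ℕ} (G : SimpleGraph n m) (col : Fin m → Fin k) (proper : IsProperColouring G col)
    (K : ℕ) .{{_ : NonZero K}} {q : ℕ} (q≥N : Parameters.N K ≤ q)
    (colours : 2 * (K + 1) * q ≤ K * k) (often : ∀ c → AppearsAtLeast col q c) where
    open Parameters K hiding (colours)
    open Darts G col proper

    matchings : ∀ s → s ≤ q → HasRainbowMatching G col s
    matchings zero    _ = (λ ()) , (λ ()) , λ { {()} }
    matchings (suc s) s<q with f , disj , rain ← matchings s (<⇒≤ s<q) =
      Round.enlarge G col proper {q} {e q≥N} {w q≥N} {ℓ} {B} often (Parameters.colours K q≥N colours) (q≤ℓw q≥N) ≤-refl (B<w q≥N)
        (few-bads q≥N) (slack q≥N) s<q f (λ i≢j → ¬share⇒disjoint (disj _ _ i≢j)) rain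

  -- From a rational ε to natural numbers

  module RationalBound where
    open import Data.Integer as ℤ using (+_; -[1+_])
    import Data.Integer.Properties as ℤₚ
    open import Data.Rational as ℚ using (ℚ; 0ℚ; 1ℚ; mkℚ; toℚᵘ)
    import Data.Rational.Properties as ℚₚ
    open import Data.Rational.Unnormalised as ℚᵘ using (mkℚᵘ)
    import Data.Rational.Unnormalised.Properties as ℚᵘₚ

    toℚᵘ-ℕtoℚ : ∀ a → toℚᵘ (ℕtoℚ a) ℚᵘ.≃ mkℚᵘ (+ a) 0
    toℚᵘ-ℕtoℚ a = ℚₚ.toℚᵘ-fromℚᵘ (mkℚᵘ (+ a) 0)

    toℚᵘ-factor : ∀ ε q → toℚᵘ ((ℕtoℚ 2 ℚ.* (1ℚ ℚ.+ ε)) ℚ.* ℕtoℚ q) ℚᵘ.≃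
                  (mkℚᵘ (+ 2) 0 ℚᵘ.* (mkℚᵘ (+ 1) 0 ℚᵘ.+ toℚᵘ ε)) ℚᵘ.* mkℚᵘ (+ q) 0
    toℚᵘ-factor ε q = ℚᵘₚ.≃-trans (ℚₚ.toℚᵘ-homo-* (ℕtoℚ 2 ℚ.* (1ℚ ℚ.+ ε)) (ℕtoℚ q))
      (ℚᵘₚ.*-cong (ℚᵘₚ.≃-trans (ℚₚ.toℚᵘ-homo-* (ℕtoℚ 2) (1ℚ ℚ.+ ε))
                    (ℚᵘₚ.*-cong (toℚᵘ-ℕtoℚ 2) (ℚₚ.toℚᵘ-homo-+ 1ℚ ε)))
                 (toℚᵘ-ℕtoℚ q))

    -- A positive ε has numerator at least 1, hence is at least 1/K for its denominator K. Replacing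
    -- it by 1/K and clearing denominators gives the integer inequality.
    ratio-bound : ∀ (ε : ℚ) → 0ℚ ℚ.< ε → ∀ {q k} → (ℕtoℚ 2 ℚ.* (1ℚ ℚ.+ ε)) ℚ.* ℕtoℚ q ℚ.≤ ℕtoℚ k →
                  2 * (ℚ.↧ₙ ε + 1) * q ≤ ℚ.↧ₙ ε * k
    ratio-bound (mkℚ (-[1+ _ ]) d c) (ℚ.*<* ())
    ratio-bound (mkℚ (+ zero) d c) (ℚ.*<* (ℤ.+<+ ()))
    ratio-bound ε@(mkℚ (+ suc p) d c) _ {q} {k} h = begin
      2 * (suc d + 1) * q                          ≤⟨ *-monoˡ-≤ q (*-monoʳ-≤ 2 (+-monoʳ-≤ (suc d) (s≤s z≤n))) ⟩
      2 * (suc d + suc p) * q                      ≡⟨ e₁ (suc d) (suc p) q ⟩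
      2 * (1 * suc d + suc p * 1) * q * 1          ≤⟨ ℤₚ.drop‿+≤+ (subst₂ ℤ._≤_ (sym num) (sym (ℤₚ.pos-* k _)) (cross crossed)) ⟩
      k * (1 * (1 * suc d) * 1)                    ≡⟨ e₂ k (suc d) ⟩
      suc d * k                                    ∎
      where
      open ≤-Reasoning
      e₁ : ∀ D P q → 2 * (D + P) * q ≡ 2 * (1 * D + P * 1) * q * 1
      e₁ = solve-∀
      e₂ : ∀ k D → k * (1 * (1 * D) * 1) ≡ D * k
      e₂ = solve-∀
      crossed : (mkℚᵘ (+ 2) 0 ℚᵘ.* (mkℚᵘ (+ 1) 0 ℚᵘ.+ mkℚᵘ (+ suc p) d)) ℚᵘ.* mkℚᵘ (+ q) 0 ℚᵘ.≤ mkℚᵘ (+ k) 0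
      crossed = ℚᵘₚ.≤-respˡ-≃ (toℚᵘ-factor ε q) (ℚᵘₚ.≤-respʳ-≃ (toℚᵘ-ℕtoℚ k) (ℚₚ.toℚᵘ-mono-≤ h))
      cross : ∀ {x y} → x ℚᵘ.≤ y → ℚᵘ.↥ x ℤ.* ℚᵘ.↧ y ℤ.≤ ℚᵘ.↥ y ℤ.* ℚᵘ.↧ x
      cross (ℚᵘ.*≤* r) = r
      num : + (2 * (1 * suc d + suc p * 1) * q * 1) ≡
            + 2 ℤ.* (+ 1 ℤ.* + suc d ℤ.+ + suc p ℤ.* + 1) ℤ.* + q ℤ.* + 1
      num = trans (ℤₚ.pos-* (2 * (1 * suc d + suc p * 1) * q) 1) (cong (ℤ._* + 1)
              (trans (ℤₚ.pos-* (2 * (1 * suc d + suc p * 1)) q) (cong (ℤ._* + q)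
                (trans (ℤₚ.pos-* 2 (1 * suc d + suc p * 1)) (cong (+ 2 ℤ.*_)
                  (trans (ℤₚ.pos-+ (1 * suc d) (suc p * 1)) (cong₂ ℤ._+_ (ℤₚ.pos-* 1 (suc d)) (ℤₚ.pos-* (suc p) 1))))))))

open RainbowMatchings
open RationalBound

open import Data.Nat.Properties using (≤-refl)
open import Data.Rational using (ℚ; 0ℚ; 1ℚ; _+_; _*_; _<_; _≤_; ↧ₙ_)

theorem1p11 : (ε : ℚ) → 0ℚ < ε →
    ∃ λ (N : ℕ) → (q : ℕ) → q ≥ N →
    (n m k : ℕ) (G : SimpleGraph n m) (col : Fin m → Fin k) →
    IsProperColouring G col →
    ((ℕtoℚ 2 * (1ℚ + ε)) * ℕtoℚ q ≤ ℕtoℚ k) →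
    (∀ c → AppearsAtLeast col q c) →
    HasRainbowMatching G col q
theorem1p11 ε 0<ε = Parameters.N (↧ₙ ε) , λ q q≥N n m k G col proper many often →
  matchings G col proper (↧ₙ ε) q≥N (ratio-bound ε 0<ε many) often q ≤-refl
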